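{- Let $\mathbf{x}=\begin{pmatrix} x_1 \\ x_2 \end{pmatrix}$ be a point in $\mathbb{R}^2$ with irrational slope $x_1/x_2$, and let $\Gamma=\mathrm{SL}(2,\mathbb{Z})$. (i) There exist infinitely many matrices $\gamma\in\Gamma$ such that $$|\gamma\mathbf{x}|\le \frac{|\mathbf{x}|}{|\gamma|}.$$ (ii) Let $\mathbf{y}=\begin{pmatrix} y_1 \\ y_2 \end{pmatrix}\in\mathbb{R}^2\setminus\{\mathbf{0}\}$. Assume that either $y_2\neq 0$ and the slope $y_1/y_2$ is a rational number $a/b$ (with $a,b$ integers, $b\ne 0$), or that $y_2=0$, in which case put $a=1$ and $b=0$. Then there exist infinitely many matrices $\gamma\in\Gamma$ such that $$|\gamma\mathbf{x}-\mathbf{y}|\le\frac{c}{|\gamma|^{1/2}}\quad\text{with}\quad c=2\sqrt{3}\,\max(|a|,|b|)\,|\mathbf{x}|^{1/2}|\mathbf{y}|^{1/2}.$$ (iii) Let $\mathbf{y}=\begin{pmatrix} y_1 \\ y_2 \end{pmatrix}\in\mathbb{R}^2$ be a point whose slope $y_1/y_2$ is irrational. Then there exist infinitely many matrices $\gamma\in\Gamma$ such that $$|\gamma\mathbf{x}-\mathbf{y}|\le\frac{c'}{|\gamma|^{1/3}}\quad\text{with}\quad c'=7\sqrt{5}\,|\mathbf{x}|^{1/3}|\mathbf{y}|^{2/3}.$$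
   Context: $\Gamma=\mathrm{SL}(2,\mathbb{Z})$ acts on column vectors of $\mathbb{R}^2$ by left multiplication. For $\mathbf{z}=\begin{pmatrix} z_1 \\ z_2 \end{pmatrix}\in\mathbb{R}^2$, $|\mathbf{z}|=\max(|z_1|,|z_2|)$, and the slope of $\mathbf{z}$ is $z_1/z_2$ (when $z_2\ne0$). For a matrix $\gamma$, $|\gamma|$ is the maximum of the absolute values of its entries. $\mathbf{0}$ denotes the origin of $\mathbb{R}^2$. -}

module Defs where

open import Algebra.Bundles using (CommutativeRing; Semiring)
open import Algebra.Structures using (IsCommutativeRing)
open import Data.Integer.Base as ℤ using (ℤ; +_; -[1+_])
open import Data.List.Base using (List)
open import Data.List.Membership.Propositional using (_∉_)
open import Data.Nat.Base as ℕ using (ℕ; zero; suc; NonZero)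
open import Data.Product.Base using (∃; _×_; _,_; proj₁; proj₂)
open import Data.Rational.Base using (ℚ; ↥_; ↧_)
open import Data.Sum.Base using (_⊎_; inj₁; inj₂)
open import Level using (_⊔_; Lift; lift) renaming (suc to lsuc)
open import Relation.Binary.Bundles using (StrictTotalOrder; TotalOrder; DecTotalOrder)
open import Relation.Binary.Core using (Rel)
open import Relation.Binary.Definitions using (tri<; tri≈; tri>)
open import Relation.Binary.PropositionalEquality.Core using (_≡_; _≢_)
open import Relation.Binary.Structures using (IsStrictTotalOrder)
open import Relation.Nullary.Negation.Core using (¬_; contradiction)
open import Relation.Unary using (Pred)

import Algebra.Construct.NaturalChoice.Max as NaturalMax
import Algebra.Definitions.RawSemiring as RawSemiringOps
import Algebra.Properties.Ring as RingProperties
import Algebra.Properties.Semiring.Exp as ExpProperties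
import Relation.Binary.Construct.StrictToNonStrict as ToNonStrict
import Relation.Binary.Properties.StrictTotalOrder as STOProperties
import Relation.Binary.Reasoning.StrictPartialOrder as OrderReasoning

-- The real numbers, axiomatised as a complete ordered field.
--
-- The axioms are the classical ones: trichotomy is a disjunction, and
-- a supremum is an upper bound s such that every u < s is exceeded by
-- some element of the set.  With the latter taken existentially, the
-- Archimedean property and excluded middle for propositions at the
-- level of `complete` are consequences (for the latter, take the supremum of
-- {0} ∪ {1 | Q}), so no separate classical axiom is assumed.  Any two
-- such fields are isomorphic.

record CompleteOrderedField c ℓ : Set (lsuc (c ⊔ ℓ)) where
  infix  8 _⁻¹
  infix  8 -_
  infixl 7 _*_
  infixl 6 _+_
  infix  4 _≈_ _≉_ _<_

  field
    Carrier : Set c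
    _≈_     : Rel Carrier ℓ
    _<_     : Rel Carrier ℓ
    _+_     : Carrier → Carrier → Carrier
    _*_     : Carrier → Carrier → Carrier
    -_      : Carrier → Carrier
    0#      : Carrier
    1#      : Carrier
    _⁻¹     : Carrier → Carrier

  _≉_ : Rel Carrier ℓ
  x ≉ y = ¬ (x ≈ y)

  open ToNonStrict _≈_ _<_ public using (_≤_)

  UpperBound : ∀ {p} → Pred Carrier p → Pred Carrier (c ⊔ ℓ ⊔ p)
  UpperBound P s = ∀ {t} → P t → t ≤ s

  IsSupremum : ∀ {p} → Pred Carrier p → Pred Carrier (c ⊔ ℓ ⊔ p)
  IsSupremum P s = UpperBound P s × (∀ {u} → u < s → ∃ λ t → P t × u < t)

  field
    isCommutativeRing  : IsCommutativeRing _≈_ _+_ _*_ -_ 0# 1#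
    0≉1                : 0# ≉ 1#
    -- nothing is required of 0# ⁻¹
    ⁻¹-inverseʳ        : ∀ {x} → x ≉ 0# → x * x ⁻¹ ≈ 1#
    isStrictTotalOrder : IsStrictTotalOrder _≈_ _<_
    +-monoʳ-<          : ∀ z {x y} → x < y → z + x < z + y
    *-pos              : ∀ {x y} → 0# < x → 0# < y → 0# < x * y
    complete           : (P : Pred Carrier (c ⊔ ℓ)) → ∃ P → ∃ (UpperBound P) →
                         ∃ (IsSupremum P)

  commutativeRing : CommutativeRing c ℓ
  commutativeRing = record { isCommutativeRing = isCommutativeRing }

  strictTotalOrder : StrictTotalOrder c ℓ ℓ
  strictTotalOrder = record { isStrictTotalOrder = isStrictTotalOrder }

  totalOrder : TotalOrder c ℓ ℓ
  totalOrder = DecTotalOrder.totalOrder (STOProperties.decTotalOrder strictTotalOrder)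

module Reals {c ℓ} (R : CompleteOrderedField c ℓ) where

  open CompleteOrderedField R public
    using ( _≈_; _≉_; _<_; _≤_; _+_; _*_; -_; 0#; 1#; _⁻¹; 0≉1; ⁻¹-inverseʳ
          ; +-monoʳ-<; *-pos; UpperBound; IsSupremum; complete
          ; commutativeRing; strictTotalOrder; totalOrder)
    renaming (Carrier to ℝ)

  open CommutativeRing commutativeRing
    using ( ring; semiring; refl; sym; trans; +-cong; +-congˡ
          ; +-congʳ; *-cong; *-congˡ; *-congʳ; +-assoc; +-comm; *-assoc; *-comm
          ; +-identityˡ; +-identityʳ; *-identityˡ; *-identityʳ; distribˡ; distribʳ
          ; zeroˡ; zeroʳ; -‿cong; -‿inverseˡ; -‿inverseʳ)
  open RawSemiringOps (Semiring.rawSemiring semiring) public using (_^_) renaming (_×_ to _×ℝ_)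
  open NaturalMax totalOrder public using () renaming (_⊔_ to _⊔ℝ_)

  infixl 6 _-_
  infixl 7 _/_

  _-_ : ℝ → ℝ → ℝ
  x - y = x + - y

  _/_ : ℝ → ℝ → ℝ
  x / y = x * y ⁻¹

  abs : ℝ → ℝ
  abs x = x ⊔ℝ (- x)

  fromℕ : ℕ → ℝ
  fromℕ n = n ×ℝ 1#

  fromℤ : ℤ → ℝ
  fromℤ (+ n)    = fromℕ n
  fromℤ -[1+ n ] = - fromℕ (suc n)

  fromℚ : ℚ → ℝ
  fromℚ q = fromℤ (↥ q) / fromℤ (↧ q)

  Irrational : ℝ → Set ℓ
  Irrational r = ¬ (∃ λ q → r ≈ fromℚ q)

  private
    module < = StrictTotalOrder strictTotalOrder
    module ≤ = TotalOrder totalOrder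
    open RingProperties ring using (-‿distribˡ-*; -‿involutive)
    open OrderReasoning <.strictPartialOrder

    ≤∧≮ : ∀ {a} {A : Set a} {x y} → x ≤ y → y < x → A
    ≤∧≮ (inj₁ x<y) y<x = contradiction y<x (<.asym x<y)
    ≤∧≮ (inj₂ x≈y) y<x = contradiction y<x (<.irrefl (sym x≈y))

    +-monoˡ-< : ∀ z {x y} → x < y → x + z < y + z
    +-monoˡ-< z {x} {y} x<y = begin-strict
      x + z ≈⟨ +-comm x z ⟩
      z + x <⟨ +-monoʳ-< z x<y ⟩
      z + y ≈⟨ +-comm z y ⟩
      y + z ∎

    +-monoʳ-≤ : ∀ z {x y} → x ≤ y → z + x ≤ z + y
    +-monoʳ-≤ z (inj₁ x<y) = inj₁ (+-monoʳ-< z x<y)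
    +-monoʳ-≤ z (inj₂ x≈y) = inj₂ (+-congˡ x≈y)

    +-monoˡ-≤ : ∀ z {x y} → x ≤ y → x + z ≤ y + z
    +-monoˡ-≤ z (inj₁ x<y) = inj₁ (+-monoˡ-< z x<y)
    +-monoˡ-≤ z (inj₂ x≈y) = inj₂ (+-congʳ x≈y)

    +-mono-≤ : ∀ {x y u v} → x ≤ y → u ≤ v → x + u ≤ y + v
    +-mono-≤ {x} {y} {u} {v} x≤y u≤v = ≤.trans (+-monoˡ-≤ u x≤y) (+-monoʳ-≤ y u≤v)

    x-z+z : ∀ x z → (x - z) + z ≈ x
    x-z+z x z = trans (+-assoc x (- z) z) (trans (+-congˡ (-‿inverseˡ z)) (+-identityʳ x))

    z+[x-z] : ∀ x z → z + (x - z) ≈ x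
    z+[x-z] x z = trans (+-comm z (x - z)) (x-z+z x z)

    x<y⇒0<y-x : ∀ {x y} → x < y → 0# < y - x
    x<y⇒0<y-x {x} {y} x<y = begin-strict
      0#    ≈⟨ -‿inverseʳ x ⟨
      x - x <⟨ +-monoˡ-< (- x) x<y ⟩
      y - x ∎

    x≤y⇒0≤y-x : ∀ {x y} → x ≤ y → 0# ≤ y - x
    x≤y⇒0≤y-x {x} {y} x≤y = begin
      0#    ≈⟨ -‿inverseʳ x ⟨
      x - x ≤⟨ +-monoˡ-≤ (- x) x≤y ⟩
      y - x ∎

    *-monoʳ-< : ∀ {z x y} → 0# < z → x < y → z * x < z * y
    *-monoʳ-< {z} {x} {y} 0<z x<y = begin-strict
      z * x                   ≈⟨ +-identityˡ _ ⟨
      0# + z * x              <⟨ +-monoˡ-< (z * x) (*-pos 0<z (x<y⇒0<y-x x<y)) ⟩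
      z * (y - x) + z * x     ≈⟨ distribˡ z (y - x) x ⟨
      z * ((y - x) + x)       ≈⟨ *-congˡ (x-z+z y x) ⟩
      z * y                   ∎

    *-monoʳ-≤ : ∀ {z x y} → 0# ≤ z → x ≤ y → z * x ≤ z * y
    *-monoʳ-≤ (inj₁ 0<z) (inj₁ x<y) = inj₁ (*-monoʳ-< 0<z x<y)
    *-monoʳ-≤ (inj₁ 0<z) (inj₂ x≈y) = inj₂ (*-congˡ x≈y)
    *-monoʳ-≤ {z} {x} {y} (inj₂ 0≈z) _ = inj₂ (trans (z*≈0 x) (sym (z*≈0 y)))
      where
      z*≈0 : ∀ t → z * t ≈ 0#
      z*≈0 t = trans (*-congʳ (sym 0≈z)) (zeroˡ t)

    *-monoˡ-≤ : ∀ {z x y} → 0# ≤ z → x ≤ y → x * z ≤ y * z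
    *-monoˡ-≤ {z} {x} {y} 0≤z x≤y = begin
      x * z ≈⟨ *-comm x z ⟩
      z * x ≤⟨ *-monoʳ-≤ 0≤z x≤y ⟩
      z * y ≈⟨ *-comm z y ⟩
      y * z ∎

    *-nonneg : ∀ {x y} → 0# ≤ x → 0# ≤ y → 0# ≤ x * y
    *-nonneg {x} {y} 0≤x 0≤y = begin
      0#     ≈⟨ zeroʳ x ⟨
      x * 0# ≤⟨ *-monoʳ-≤ 0≤x 0≤y ⟩
      x * y  ∎

    +-nonneg : ∀ {x y} → 0# ≤ x → 0# ≤ y → 0# ≤ x + y
    +-nonneg {x} {y} 0≤x 0≤y = begin
      0#      ≈⟨ +-identityˡ 0# ⟨
      0# + 0# ≤⟨ +-mono-≤ 0≤x 0≤y ⟩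
      x + y   ∎

    0<1 : 0# < 1#
    0<1 with <.compare 0# 1#
    ... | tri< 0<1 _ _ = 0<1
    ... | tri≈ _ 0≈1 _ = contradiction 0≈1 0≉1
    ... | tri> _ _ 1<0 = contradiction 1<0 (<.asym 0<1′)
      where
      0<-1 : 0# < - 1#
      0<-1 = begin-strict
        0#        <⟨ x<y⇒0<y-x 1<0 ⟩
        0# - 1#   ≈⟨ +-identityˡ (- 1#) ⟩
        - 1#      ∎
      0<1′ : 0# < 1#
      0<1′ = begin-strict
        0#            <⟨ *-pos 0<-1 0<-1 ⟩
        - 1# * - 1#   ≈⟨ -‿distribˡ-* 1# (- 1#) ⟨
        - (1# * - 1#) ≈⟨ -‿cong (*-identityˡ (- 1#)) ⟩
        - (- 1#)      ≈⟨ -‿involutive 1# ⟩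
        1#            ∎

    ⁻¹-pos : ∀ {x} → 0# < x → 0# < x ⁻¹
    ⁻¹-pos {x} 0<x with <.compare 0# (x ⁻¹)
    ... | tri< 0<i _ _ = 0<i
    ... | tri≈ _ 0≈i _ = contradiction
      (trans (sym (zeroʳ x)) (trans (*-congˡ 0≈i) (⁻¹-inverseʳ λ x≈0 → <.irrefl (sym x≈0) 0<x))) 0≉1
    ... | tri> _ _ i<0 = contradiction
      (begin-strict
        1#       ≈⟨ ⁻¹-inverseʳ (λ x≈0 → <.irrefl (sym x≈0) 0<x) ⟨
        x * x ⁻¹ <⟨ *-monoʳ-< 0<x i<0 ⟩
        x * 0#   ≈⟨ zeroʳ x ⟩
        0#       ∎)
      (<.asym 0<1)

    ^-nonneg : ∀ {x} n → 0# ≤ x → 0# ≤ x ^ n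
    ^-nonneg zero    0≤x = inj₁ 0<1
    ^-nonneg (suc n) 0≤x = *-nonneg 0≤x (^-nonneg n 0≤x)

    ^-mono-≤ : ∀ {x y} n → 0# ≤ x → x ≤ y → x ^ n ≤ y ^ n
    ^-mono-≤ zero      0≤x x≤y = inj₂ refl
    ^-mono-≤ {x} {y} (suc n) 0≤x x≤y = begin
      x * x ^ n ≤⟨ *-monoʳ-≤ 0≤x (^-mono-≤ n 0≤x x≤y) ⟩
      x * y ^ n ≤⟨ *-monoˡ-≤ (^-nonneg n (≤.trans 0≤x x≤y)) x≤y ⟩
      y * y ^ n ∎

    1≤^ : ∀ {x} n → 1# ≤ x → 1# ≤ x ^ n
    1≤^ zero      1≤x = inj₂ refl
    1≤^ {x} (suc n) 1≤x = begin
      1#        ≈⟨ *-identityʳ 1# ⟨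
      1# * 1#   ≤⟨ *-monoʳ-≤ (inj₁ 0<1) (1≤^ n 1≤x) ⟩
      1# * x ^ n ≤⟨ *-monoˡ-≤ (^-nonneg n (≤.trans (inj₁ 0<1) 1≤x)) 1≤x ⟩
      x * x ^ n ∎

    x≤x^[1+n] : ∀ {x} n → 1# ≤ x → x ≤ x ^ suc n
    x≤x^[1+n] {x} n 1≤x = begin
      x          ≈⟨ *-identityʳ x ⟨
      x * 1#     ≤⟨ *-monoʳ-≤ (≤.trans (inj₁ 0<1) 1≤x) (1≤^ n 1≤x) ⟩
      x * x ^ n  ∎

  -- The n-th root of x, for n ≥ 1 and x ≥ 0, is the supremum of the t
  -- with t ^ n ≤ x.  The alternative t ≤ 0# only serves to make the
  -- function total: it gives the value 0# at negative x.

  BelowRoot : ℕ → ℝ → Pred ℝ (c ⊔ ℓ)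
  BelowRoot n x t = Lift c (t ≤ 0# ⊎ t ^ n ≤ x)

  private
    belowRoot-bounded : ∀ n x → ∃ (UpperBound (BelowRoot (suc n) x))
    belowRoot-bounded n x = 1# ⊔ℝ x , bound
      where
      open NaturalMax totalOrder using (x≤x⊔y; x≤y⊔x)
      bound : UpperBound (BelowRoot (suc n) x) (1# ⊔ℝ x)
      bound {t} t∈ with ≤.total t (1# ⊔ℝ x)
      bound {t} t∈                          | inj₁ t≤m = t≤m
      bound {t} (lift (inj₁ t≤0))     | inj₂ _   =
        ≤.trans t≤0 (≤.trans (inj₁ 0<1) (x≤x⊔y 1# x))
      bound {t} (lift (inj₂ tⁿ≤x))    | inj₂ m≤t =
        ≤.trans (x≤x^[1+n] n (≤.trans (x≤x⊔y 1# x) m≤t)) (≤.trans tⁿ≤x (x≤y⊔x 1# x))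

    root-sup : ∀ n x → ∃ (IsSupremum (BelowRoot (suc n) x))
    root-sup n x = complete (BelowRoot (suc n) x)
      (0# , lift (inj₁ (inj₂ refl))) (belowRoot-bounded n x)

  root : (n : ℕ) .{{_ : NonZero n}} → ℝ → ℝ
  root (suc n) x = proj₁ (root-sup n x)

  infix 9 √_ ∛_

  √_ : ℝ → ℝ
  √ x = root 2 x

  ∛_ : ℝ → ℝ
  ∛ x = root 3 x

  private
    -- (u + h) ^ n ≤ u ^ n + h * C uniformly for 0 ≤ u ≤ B and 0 ≤ h ≤ 1
    ^-lipschitz : ∀ n B → 0# ≤ B → ∃ λ C → 0# ≤ C ×
      (∀ {u h} → 0# ≤ u → u ≤ B → 0# ≤ h → h ≤ 1# → (u + h) ^ n ≤ u ^ n + h * C)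
    ^-lipschitz zero B 0≤B = 0# , inj₂ refl , λ {u} {h} _ _ _ _ →
      inj₂ (sym (trans (+-congˡ (zeroʳ h)) (+-identityʳ 1#)))
    ^-lipschitz (suc n) B 0≤B with ^-lipschitz n B 0≤B
    ... | C , 0≤C , lip = B ^ n + (B + 1#) * C
        , +-nonneg (^-nonneg n 0≤B) (*-nonneg (+-nonneg 0≤B (inj₁ 0<1)) 0≤C) , step
      where
      step : ∀ {u h} → 0# ≤ u → u ≤ B → 0# ≤ h → h ≤ 1# →
             (u + h) ^ suc n ≤ u ^ suc n + h * (B ^ n + (B + 1#) * C)
      step {u} {h} 0≤u u≤B 0≤h h≤1 = begin
        (u + h) * (u + h) ^ n
          ≤⟨ *-monoʳ-≤ (+-nonneg 0≤u 0≤h) (lip 0≤u u≤B 0≤h h≤1) ⟩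
        (u + h) * (u ^ n + h * C)
          ≈⟨ distribˡ (u + h) (u ^ n) (h * C) ⟩
        (u + h) * u ^ n + (u + h) * (h * C)
          ≈⟨ +-cong (distribʳ (u ^ n) u h) swap ⟩
        (u * u ^ n + h * u ^ n) + h * ((u + h) * C)
          ≈⟨ +-assoc _ _ _ ⟩
        u * u ^ n + (h * u ^ n + h * ((u + h) * C))
          ≈⟨ +-congˡ (distribˡ h _ _) ⟨
        u * u ^ n + h * (u ^ n + (u + h) * C)
          ≤⟨ +-monoʳ-≤ _ (*-monoʳ-≤ 0≤h (+-mono-≤ (^-mono-≤ n 0≤u u≤B)
               (*-monoˡ-≤ 0≤C (+-mono-≤ u≤B h≤1)))) ⟩
        u * u ^ n + h * (B ^ n + (B + 1#) * C) ∎
        where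
        swap : (u + h) * (h * C) ≈ h * ((u + h) * C)
        swap = trans (sym (*-assoc _ _ _)) (trans (*-congʳ (*-comm _ _)) (*-assoc _ _ _))

    both : ∀ {a b} → 0# < a → 0# < b → ∃ λ m → 0# < m × m ≤ a × m ≤ b
    both {a} {b} 0<a 0<b with ≤.total a b
    ... | inj₁ a≤b = a , 0<a , inj₂ refl , a≤b
    ... | inj₂ b≤a = b , 0<b , b≤a , inj₂ refl

    small : ∀ {C d b} → 0# ≤ C → 0# < d → 0# < b →
            ∃ λ h → 0# < h × h ≤ 1# × h ≤ b × h * C < d
    small {C} {d} {b} 0≤C 0<d 0<b = h , 0<h , h≤1 , h≤b , hC<d
      where
      C<C+1 : C < C + 1#
      C<C+1 = begin-strict
        C      ≈⟨ +-identityʳ C ⟨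
        C + 0# <⟨ +-monoʳ-< C 0<1 ⟩
        C + 1# ∎
      0<C+1 : 0# < C + 1#
      0<C+1 = begin-strict
        0#     ≤⟨ 0≤C ⟩
        C      <⟨ C<C+1 ⟩
        C + 1# ∎
      e = d / (C + 1#)
      0<e : 0# < e
      0<e = *-pos 0<d (⁻¹-pos 0<C+1)
      m = both 0<1 0<b
      n = both (proj₁ (proj₂ m)) 0<e
      h = proj₁ n
      0<h = proj₁ (proj₂ n)
      h≤m = proj₁ (proj₂ (proj₂ n))
      h≤1 = ≤.trans h≤m (proj₁ (proj₂ (proj₂ m)))
      h≤b = ≤.trans h≤m (proj₂ (proj₂ (proj₂ m)))
      hC<d : h * C < d
      hC<d = begin-strict
        h * C                        <⟨ *-monoʳ-< 0<h C<C+1 ⟩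
        h * (C + 1#)                 ≤⟨ *-monoˡ-≤ (inj₁ 0<C+1) (proj₂ (proj₂ (proj₂ n))) ⟩
        d * (C + 1#) ⁻¹ * (C + 1#)   ≈⟨ *-assoc d _ _ ⟩
        d * ((C + 1#) ⁻¹ * (C + 1#)) ≈⟨ *-congˡ (*-comm _ _) ⟩
        d * ((C + 1#) * (C + 1#) ⁻¹) ≈⟨ *-congˡ (⁻¹-inverseʳ λ z → <.irrefl (sym z) 0<C+1) ⟩
        d * 1#                       ≈⟨ *-identityʳ d ⟩
        d                            ∎

  root-nonneg : ∀ n .{{_ : NonZero n}} x → 0# ≤ root n x
  root-nonneg (suc n) x = proj₁ (proj₂ (root-sup n x)) (lift (inj₁ (inj₂ refl)))

  root-^ : ∀ n .{{_ : NonZero n}} {x} → 0# ≤ x → root n x ^ n ≈ x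
  root-^ (suc n) {x} 0≤x = equal
    where
    N = suc n
    s = root N x
    upper = proj₁ (proj₂ (root-sup n x))
    approx = proj₂ (proj₂ (root-sup n x))
    0≤s = root-nonneg N x
    L = ^-lipschitz N s 0≤s
    C = proj₁ L
    0≤C = proj₁ (proj₂ L)
    lip = proj₂ (proj₂ L)

    too-small : ∀ {a} {A : Set a} → s ^ N < x → A
    too-small {A = A} sᴺ<x = clash (small 0≤C (x<y⇒0<y-x sᴺ<x) 0<1)
      where
      clash : (∃ λ h → 0# < h × h ≤ 1# × h ≤ 1# × h * C < x - s ^ N) → A
      clash (h , 0<h , h≤1 , _ , hC<d) = ≤∧≮ (upper (lift (inj₂ below))) s<s+h
        where
        s<s+h : s < s + h
        s<s+h = begin-strict
          s      ≈⟨ +-identityʳ s ⟨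
          s + 0# <⟨ +-monoʳ-< s 0<h ⟩
          s + h  ∎
        below : (s + h) ^ N ≤ x
        below = begin
          (s + h) ^ N           ≤⟨ lip 0≤s (inj₂ refl) (inj₁ 0<h) h≤1 ⟩
          s ^ N + h * C         ≤⟨ +-monoʳ-≤ (s ^ N) (inj₁ hC<d) ⟩
          s ^ N + (x - s ^ N)   ≈⟨ z+[x-z] x (s ^ N) ⟩
          x                     ∎

    too-large : ∀ {a} {A : Set a} → x < s ^ N → A
    too-large {A = A} x<sᴺ = positive 0≤s
      where
      clash : (∃ λ h → 0# < h × h ≤ 1# × h ≤ s × h * C < s ^ N - x) → A
      clash (h , 0<h , h≤1 , h≤s , hC<d) = absurd (approx u<s)
        where
        u = s - h
        0≤u : 0# ≤ u
        0≤u = x≤y⇒0≤y-x h≤s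
        u<s : u < s
        u<s = begin-strict
          u      ≈⟨ +-identityʳ u ⟨
          u + 0# <⟨ +-monoʳ-< u 0<h ⟩
          u + h  ≈⟨ x-z+z s h ⟩
          s      ∎
        sᴺ≤uᴺ+hC : s ^ N ≤ u ^ N + h * C
        sᴺ≤uᴺ+hC = begin
          s ^ N         ≈⟨ ExpProperties.^-congˡ semiring N (x-z+z s h) ⟨
          (u + h) ^ N   ≤⟨ lip 0≤u (inj₁ u<s) (inj₁ 0<h) h≤1 ⟩
          u ^ N + h * C ∎
        x<uᴺ : x < u ^ N
        x<uᴺ with ≤.total (u ^ N) x
        ... | inj₁ uᴺ≤x = ≤∧≮ sᴺ≤uᴺ+hC (begin-strict
          u ^ N + h * C       ≤⟨ +-monoˡ-≤ (h * C) uᴺ≤x ⟩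
          x + h * C           <⟨ +-monoʳ-< x hC<d ⟩
          x + (s ^ N - x)     ≈⟨ z+[x-z] (s ^ N) x ⟩
          s ^ N               ∎)
        ... | inj₂ (inj₁ lt) = lt
        ... | inj₂ (inj₂ x≈uᴺ) = ≤∧≮ sᴺ≤uᴺ+hC (begin-strict
          u ^ N + h * C       ≈⟨ +-congʳ (sym x≈uᴺ) ⟩
          x + h * C           <⟨ +-monoʳ-< x hC<d ⟩
          x + (s ^ N - x)     ≈⟨ z+[x-z] (s ^ N) x ⟩
          s ^ N               ∎)
        absurd : (∃ λ t → BelowRoot N x t × u < t) → A
        absurd (t , lift (inj₁ t≤0) , u<t)  = ≤∧≮ (≤.trans t≤0 0≤u) u<t
        absurd (t , lift (inj₂ tᴺ≤x) , u<t) =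
          ≤∧≮ (≤.trans (^-mono-≤ N 0≤u (inj₁ u<t)) tᴺ≤x) x<uᴺ
      positive : 0# ≤ s → A
      positive (inj₁ 0<s) = clash (small 0≤C (x<y⇒0<y-x x<sᴺ) 0<s)
      positive (inj₂ 0≈s) =
        ≤∧≮ (≤.trans (inj₂ (trans (*-congʳ (sym 0≈s)) (zeroˡ _))) 0≤x) x<sᴺ

    equal : s ^ N ≈ x
    equal with <.compare (s ^ N) x
    ... | tri< lt _ _ = too-small lt
    ... | tri≈ _ eq _ = eq
    ... | tri> _ _ gt = too-large gt

record SL₂ℤ : Set where
  constructor mat
  field
    a b c d : ℤ
    det≡1   : a ℤ.* d ℤ.- b ℤ.* c ≡ + 1

∣_∣ₘ : SL₂ℤ → ℕ
∣ γ ∣ₘ = (ℤ.∣ a ∣ ℕ.⊔ ℤ.∣ b ∣) ℕ.⊔ (ℤ.∣ c ∣ ℕ.⊔ ℤ.∣ d ∣)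
  where open SL₂ℤ γ

-- Infinitely many: no finite list exhausts the elements satisfying P.
InfinitelyMany : ∀ {a p} {A : Set a} → Pred A p → Set (a ⊔ p)
InfinitelyMany {A = A} P = (xs : List A) → ∃ λ x → P x × x ∉ xs

module Plane {c ℓ} (R : CompleteOrderedField c ℓ) where

  open Reals R public

  record ℝ² : Set c where
    constructor vec
    field
      fst snd : ℝ

  infixr 7 _·_
  infixl 6 _-ᵥ_

  _·_ : SL₂ℤ → ℝ² → ℝ²
  mat a b c d _ · vec z₁ z₂ =
    vec (fromℤ a * z₁ + fromℤ b * z₂) (fromℤ c * z₁ + fromℤ d * z₂)

  _-ᵥ_ : ℝ² → ℝ² → ℝ²
  vec z₁ z₂ -ᵥ vec w₁ w₂ = vec (z₁ - w₁) (z₂ - w₂)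

  ‖_‖ : ℝ² → ℝ
  ‖ vec z₁ z₂ ‖ = abs z₁ ⊔ℝ abs z₂

  IsOrigin : ℝ² → Set ℓ
  IsOrigin (vec z₁ z₂) = z₁ ≈ 0# × z₂ ≈ 0#

  HasIrrationalSlope : ℝ² → Set ℓ
  HasIrrationalSlope (vec z₁ z₂) = z₂ ≉ 0# × Irrational (z₁ / z₂)

  -- The pair (a , b) may be any representation a / b of a rational slope;
  -- for an infinite slope it is (1 , 0).
  HasSlope : ℝ² → ℤ → ℤ → Set ℓ
  HasSlope (vec z₁ z₂) a b =
      (z₂ ≉ 0# × b ≢ + 0 × z₁ / z₂ ≈ fromℤ a / fromℤ b)
    ⊎ (z₂ ≈ 0# × a ≡ + 1 × b ≡ + 0)

{-# OPTIONS --safe #-}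
module Submission where

-- Euclid's algorithm on the coordinates of z, a vector of irrational slope, gives a
-- sequence of bases (A , B) of ℤ² with |A·z| > |B·z| and |B| |A·z| ≤ |z|, each B being
-- the next A.  Taking A and B as rows gives (i).
--
-- For (ii) and (iii) let β = B·x and let v be a primitive vector of norm H, completed to
-- N = (v v′) ∈ SL(2,ℤ) with |v′| ≤ |v|.  Adding to A the multiple of B that brings A·x
-- within β of a prescribed t, the matrix γ = N · (A ; B) satisfies |γx − t v| ≤ 2Hβ, and
-- β(A₁ , A₂) = (x₂ , − x₁) + (A·x) B yields β|γ| ≤ 3H|x| + |t|H|B|.  Two successive
-- multiples of B are admissible, and their matrices differ by v ⊗ B, so that |γ| can be
-- made at least H|B|/2.
--
-- In (ii) y = t v exactly and B·x tends to 0.  In (iii) v is a convergent vⱼ to y, with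
-- |y − t vⱼ| ≤ |y|/(|vⱼ| |vⱼ₊₁|): first fix j₀, then take k with
-- |vⱼ₀|³ |Bₖ·x| < |y| ≤ |vⱼ₀|³ |Aₖ·x|, and finally j ≥ j₀ with
-- |vⱼ|³ |Bₖ·x| < |y| ≤ |vⱼ₊₁|³ |Bₖ·x|; these inequalities give |γx − y|³ |γ| ≤ 144 |x| |y|².

open import Defs
open import Algebra.Bundles using (CommutativeRing)
open import Algebra.Solver.Ring.AlmostCommutativeRing
  using (fromCommutativeRing; _-Raw-AlmostCommutative⟶_; Induced-equivalence)
open import Data.Integer.Base as ℤ using (ℤ; +_; -[1+_]; ∣_∣)
open import Data.Integer.Solver using (module +-*-Solver)
open import Data.List.Base using (List; []; _∷_)
open import Data.List.Membership.Propositional using (_∈_)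
open import Data.List.Relation.Unary.Any using (here; there)
open import Data.Maybe.Base using (just; nothing)
open import Data.Nat.Base as ℕ using (ℕ; zero; suc; _⊔_)
open import Data.Nat.GCD using (gcd; gcd-GCD; gcd[m,n]∣m; gcd[m,n]∣n; module Bézout)
open import Data.Product.Base using (∃; _×_; _,_; proj₁; proj₂)
open import Data.Rational.Base as ℚ using (↥_; ↧_)
open import Data.Sum.Base using (_⊎_; inj₁; inj₂; [_,_]′)
open import Level using (Lift; lift; lower) renaming (_⊔_ to _⊔ˡ_)
open import Relation.Binary.Bundles using (StrictTotalOrder; TotalOrder)
open import Relation.Binary.Definitions using (tri<; tri≈; tri>; WeaklyDecidable)
open import Relation.Binary.PropositionalEquality.Core as ≡ using (_≡_; _≢_)
open import Relation.Nullary.Decidable.Core using (Dec; yes; no)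
open import Relation.Nullary.Negation.Core using (¬_; contradiction)
open import Relation.Unary using (Pred)

import Algebra.Construct.NaturalChoice.Max as NaturalMax
import Algebra.Properties.Monoid.Mult as MonoidMult
import Algebra.Properties.Ring as RingProperties
import Algebra.Properties.Semiring.Mult as SemiringMult
import Algebra.Solver.Ring as RingSolver
import Data.Integer.DivMod as ℤ
import Data.Integer.Divisibility.Signed as ℤ
import Data.Integer.GCD as ℤ
import Data.Integer.Properties as ℤₚ
import Data.Nat.Properties as ℕₚ
import Data.Nat.Solver as ℕ
import Data.Rational.Properties as ℚₚ
import Relation.Binary.Reasoning.StrictPartialOrder as OrderReasoning

open +-*-Solver using () renaming
  ( solve to ℤ-solve; con to conℤ; _:*_ to _:*ℤ_; _:+_ to _:+ℤ_; _:-_ to _:-ℤ_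
  ; :-_ to :-ℤ′_; _:=_ to _:=ℤ_)

-- Integer vectors and matrices

-- The exponent 1/3 and the cubic thresholds in (iii) come from balancing two errors against the
-- size. Write X = |x|, Y = |y|, Q = |B|, H = |vⱼ|, H′ = |vⱼ₊₁| and Γ = |γ|, so that Γβ ≤ 3HX + YQ.
-- The error Hβ contributes (Hβ)³Γ, where the term with YQ is H³β · Qβ · Y; it is at most XY² once
-- H³β ≤ Y, because Qβ ≤ X. The error E ≤ Y/(HH′) contributes E³Γ; here YQ ≤ H³X is wanted, to
-- reduce the size bound to a multiple of H³X, and Y ≤ H′³β absorbs the remaining factor. The
-- condition YQ ≤ H³X follows from Y ≤ H³α and Qα ≤ X, a condition on A, whereas the other two
-- involve β; hence B must be fixed before j. But the choice of B already needs a height, and j₀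
-- supplies it: passing to a later j only enlarges H, so YQ ≤ H³X survives, and H₀³β < Y starts the
-- search for j. Large |γ| is then forced by vⱼ₀ alone, since |B| ≥ 1.

∣τ*i∣≡∣i∣ : ∀ τ i → ∣ τ ∣ ≡ 1 → ∣ τ ℤ.* i ∣ ≡ ∣ i ∣
∣τ*i∣≡∣i∣ τ i ∣τ∣≡1 = ≡.trans (ℤₚ.abs-* τ i) (≡.trans (≡.cong (ℕ._* ∣ i ∣) ∣τ∣≡1) (ℕₚ.*-identityˡ ∣ i ∣))

‖_,_‖ℤ : ℤ → ℤ → ℕ
‖ a , b ‖ℤ = ∣ a ∣ ⊔ ∣ b ∣

m⊔n≤m+n : ∀ m n → m ⊔ n ℕ.≤ m ℕ.+ n
m⊔n≤m+n m n = ℕₚ.⊔-lub (ℕₚ.m≤m+n m n) (ℕₚ.m≤n+m n m)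

m+n≤2[m⊔n] : ∀ m n → m ℕ.+ n ℕ.≤ 2 ℕ.* (m ⊔ n)
m+n≤2[m⊔n] m n = ℕₚ.≤-trans (ℕₚ.+-mono-≤ (ℕₚ.m≤m⊔n m n) (ℕₚ.m≤n⊔m m n))
  (ℕₚ.≤-reflexive (≡.cong (m ⊔ n ℕ.+_) (≡.sym (ℕₚ.+-identityʳ _))))

+-interchange : ∀ p q p′ q′ → (p ℕ.+ q) ℕ.+ (p′ ℕ.+ q′) ≡ (p ℕ.+ p′) ℕ.+ (q ℕ.+ q′)
+-interchange = solve 4 (λ p q p′ q′ → (p :+ q) :+ (p′ :+ q′) := (p :+ p′) :+ (q :+ q′)) ≡.refl
  where open ℕ.+-*-Solver

-- A discrete intermediate value argument: walking down from the end where `Q` holds, the first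
-- index satisfying `P` is followed by one satisfying `Q`. It provides integer quotients as well as
-- the indices k and j in (iii).
crossing : ∀ {p q} {P : ℕ → Set p} {Q : ℕ → Set q} → (∀ n → P n ⊎ Q n) →
           ∀ m d → P m → Q (suc (d ℕ.+ m)) → ∃ λ n → m ℕ.≤ n × P n × Q (suc n)
crossing either m zero    Pm Qm+d = m , ℕₚ.≤-refl , Pm , Qm+d
crossing either m (suc d) Pm Qm+d with either (suc (d ℕ.+ m))
... | inj₁ P′ = suc (d ℕ.+ m) , ℕₚ.m≤n⇒m≤1+n (ℕₚ.m≤n+m m d) , P′ , Qm+d
... | inj₂ Q′ = crossing either m d Pm Q′

unit-square : ∀ i → ∣ i ∣ ≡ 1 → i ℤ.* i ≡ + 1
unit-square (+ 1)     _ = ≡.refl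
unit-square -[1+ 0 ]  _ = ≡.refl

-- The determinant D is itself the required sign, as D² = 1.
orient : ∀ a b c d → ∣ a ℤ.* d ℤ.- b ℤ.* c ∣ ≡ 1 →
         ∃ λ σ → ∣ σ ∣ ≡ 1 × (σ ℤ.* a) ℤ.* d ℤ.- (σ ℤ.* b) ℤ.* c ≡ + 1
orient a b c d ∣D∣≡1 = D , ∣D∣≡1 , ≡.trans
  (ℤ-solve 5 (λ s a b c d → (s :*ℤ a) :*ℤ d :-ℤ (s :*ℤ b) :*ℤ c :=ℤ s :*ℤ (a :*ℤ d :-ℤ b :*ℤ c))
    ≡.refl D a b c d)
  (unit-square D ∣D∣≡1)
  where D = a ℤ.* d ℤ.- b ℤ.* c

-- For b ≠ 0 a multiple of (a , b) may be subtracted from (c , d). Taking d′ to be the remainder of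
-- d modulo b gives d′ < |b|, and with m the norm of (a , b) the determinant then forces |b||c′| =
-- |a d′ - 1| ≤ m (d′ + 1) ≤ m|b|. For b = 0 the determinant leaves only a = ±1, and (0 , a) serves.
completion : ∀ a b c d → a ℤ.* d ℤ.- b ℤ.* c ≡ + 1 →
             ∃ λ c′ → ∃ λ d′ → a ℤ.* d′ ℤ.- b ℤ.* c′ ≡ + 1 × ‖ c′ , d′ ‖ℤ ℕ.≤ ‖ a , b ‖ℤ
completion a b c d det = by (b ℤₚ.≟ + 0)
  where
  by : Dec (b ≡ + 0) → ∃ λ c′ → ∃ λ d′ → a ℤ.* d′ ℤ.- b ℤ.* c′ ≡ + 1 × ‖ c′ , d′ ‖ℤ ℕ.≤ ‖ a , b ‖ℤ
  by (yes ≡.refl) = + 0 , a , ≡.trans (ℤ-solve 1 (λ a → a :*ℤ a :-ℤ b₀ :*ℤ b₀ :=ℤ a :*ℤ a) ≡.refl a)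
      (unit-square a ∣a∣≡1) , ℕₚ.m≤m⊔n ∣ a ∣ 0
    where
    b₀ : ∀ {n} → +-*-Solver.Polynomial n
    b₀ = conℤ (+ 0)
    ∣a∣≡1 : ∣ a ∣ ≡ 1
    ∣a∣≡1 = ℕₚ.m*n≡1⇒m≡1 ∣ a ∣ ∣ d ∣ (≡.trans (≡.sym (ℤₚ.abs-* a d)) (≡.cong ∣_∣
      (≡.trans (ℤ-solve 3 (λ a c d → a :*ℤ d :=ℤ a :*ℤ d :-ℤ b₀ :*ℤ c) ≡.refl a c d) det)))
  by (no b≢0) = c′ , d′ , det′ , ℕₚ.⊔-lub ∣c′∣≤m (ℕₚ.≤-trans (ℕₚ.<⇒≤ r<∣b∣) (ℕₚ.m≤n⊔m ∣ a ∣ ∣ b ∣))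
    where
    instance b≠0 = ℤ.≢-nonZero b≢0
    r = d ℤ.% b
    k = d ℤ./ b
    m = ‖ a , b ‖ℤ
    c′ = c ℤ.- k ℤ.* a
    d′ = + r
    r<∣b∣ : r ℕ.< ∣ b ∣
    r<∣b∣ = ℤ.n%d<d d b
    det′ : a ℤ.* d′ ℤ.- b ℤ.* c′ ≡ + 1
    det′ = ≡.trans (ℤ-solve 5 (λ a b c r k → a :*ℤ r :-ℤ b :*ℤ (c :-ℤ k :*ℤ a)
        :=ℤ a :*ℤ (r :+ℤ k :*ℤ b) :-ℤ b :*ℤ c) ≡.refl a b c d′ k)
      (≡.trans (≡.cong (λ x → a ℤ.* x ℤ.- b ℤ.* c) (≡.sym (ℤ.a≡a%n+[a/n]*n d b))) det)
    bc′ : b ℤ.* c′ ≡ a ℤ.* d′ ℤ.- + 1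
    bc′ = ≡.trans (ℤ-solve 2 (λ x y → y :=ℤ x :-ℤ (x :-ℤ y)) ≡.refl (a ℤ.* d′) (b ℤ.* c′))
        (≡.cong (λ x → a ℤ.* d′ ℤ.- x) det′)
    1≤m : 1 ℕ.≤ m
    1≤m = ℕₚ.≤-trans (ℕₚ.≤-trans (ℕ.s≤s ℕ.z≤n) r<∣b∣) (ℕₚ.m≤n⊔m ∣ a ∣ ∣ b ∣)
    open ℕₚ.≤-Reasoning
    ∣c′∣*∣b∣≤m*∣b∣ : ∣ c′ ∣ ℕ.* ∣ b ∣ ℕ.≤ m ℕ.* ∣ b ∣
    ∣c′∣*∣b∣≤m*∣b∣ = begin
      ∣ c′ ∣ ℕ.* ∣ b ∣          ≡⟨ ℕₚ.*-comm ∣ c′ ∣ ∣ b ∣ ⟩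
      ∣ b ∣ ℕ.* ∣ c′ ∣          ≡⟨ ℤₚ.abs-* b c′ ⟨
      ∣ b ℤ.* c′ ∣              ≡⟨ ≡.cong ∣_∣ bc′ ⟩
      ∣ a ℤ.* d′ ℤ.- + 1 ∣      ≤⟨ ℤₚ.∣i-j∣≤∣i∣+∣j∣ (a ℤ.* d′) (+ 1) ⟩
      ∣ a ℤ.* d′ ∣ ℕ.+ 1        ≡⟨ ≡.cong (ℕ._+ 1) (ℤₚ.abs-* a d′) ⟩
      ∣ a ∣ ℕ.* r ℕ.+ 1         ≤⟨ ℕₚ.+-mono-≤ (ℕₚ.*-monoˡ-≤ r (ℕₚ.m≤m⊔n ∣ a ∣ ∣ b ∣)) 1≤m ⟩
      m ℕ.* r ℕ.+ m             ≡⟨ ℕₚ.+-comm (m ℕ.* r) m ⟩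
      m ℕ.+ m ℕ.* r             ≡⟨ ℕₚ.*-suc m r ⟨
      m ℕ.* suc r               ≤⟨ ℕₚ.*-monoʳ-≤ m r<∣b∣ ⟩
      m ℕ.* ∣ b ∣               ∎
    ∣c′∣≤m : ∣ c′ ∣ ℕ.≤ m
    ∣c′∣≤m = ℕₚ.*-cancelʳ-≤ (∣ c′ ∣) m (∣ b ∣) ∣c′∣*∣b∣≤m*∣b∣

-- The matrix with columns (p , r) and (p′ , r′), times the matrix with rows
-- (a₁ , a₂) + l (b₁ , b₂) and (b₁ , b₂).
entry : (p p′ a b l : ℤ) → ℤ
entry p p′ a b l = p ℤ.* (a ℤ.+ l ℤ.* b) ℤ.+ p′ ℤ.* b

product : ∀ p r p′ r′ a₁ a₂ b₁ b₂ → p ℤ.* r′ ℤ.- r ℤ.* p′ ≡ + 1 → a₁ ℤ.* b₂ ℤ.- a₂ ℤ.* b₁ ≡ + 1 → ℤ → SL₂ℤ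
product p r p′ r′ a₁ a₂ b₁ b₂ det-v det-B l =
  mat (entry p p′ a₁ b₁ l) (entry p p′ a₂ b₂ l) (entry r r′ a₁ b₁ l) (entry r r′ a₂ b₂ l)
    (≡.trans (ℤ-solve 9 (λ p r p′ r′ a₁ a₂ b₁ b₂ l →
        (p :*ℤ (a₁ :+ℤ l :*ℤ b₁) :+ℤ p′ :*ℤ b₁) :*ℤ (r :*ℤ (a₂ :+ℤ l :*ℤ b₂) :+ℤ r′ :*ℤ b₂)
        :-ℤ (p :*ℤ (a₂ :+ℤ l :*ℤ b₂) :+ℤ p′ :*ℤ b₂) :*ℤ (r :*ℤ (a₁ :+ℤ l :*ℤ b₁) :+ℤ r′ :*ℤ b₁)
        :=ℤ (p :*ℤ r′ :-ℤ r :*ℤ p′) :*ℤ (a₁ :*ℤ b₂ :-ℤ a₂ :*ℤ b₁)) ≡.refl p r p′ r′ a₁ a₂ b₁ b₂ l)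
      (≡.cong₂ ℤ._*_ det-v det-B))

entry-step : ∀ p p′ a b l → ∣ p ∣ ℕ.* ∣ b ∣ ℕ.≤ ∣ entry p p′ a b (l ℤ.+ + 1) ∣ ℕ.+ ∣ entry p p′ a b l ∣
entry-step p p′ a b l = begin
  ∣ p ∣ ℕ.* ∣ b ∣                                                ≡⟨ ℤₚ.abs-* p b ⟨
  ∣ p ℤ.* b ∣                                                    ≡⟨ ≡.cong ∣_∣ difference ⟨
  ∣ entry p p′ a b (l ℤ.+ + 1) ℤ.- entry p p′ a b l ∣            ≤⟨ ℤₚ.∣i-j∣≤∣i∣+∣j∣
      (entry p p′ a b (l ℤ.+ + 1)) (entry p p′ a b l) ⟩
  ∣ entry p p′ a b (l ℤ.+ + 1) ∣ ℕ.+ ∣ entry p p′ a b l ∣        ∎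
  where
  open ℕₚ.≤-Reasoning
  difference : entry p p′ a b (l ℤ.+ + 1) ℤ.- entry p p′ a b l ≡ p ℤ.* b
  difference = ℤ-solve 5 (λ p p′ a b l →
    p :*ℤ (a :+ℤ (l :+ℤ conℤ (+ 1)) :*ℤ b) :+ℤ p′ :*ℤ b :-ℤ (p :*ℤ (a :+ℤ l :*ℤ b) :+ℤ p′ :*ℤ b)
        :=ℤ p :*ℤ b)
    ≡.refl p p′ a b l

⊔-product-lub : ∀ m n o p {e} → m ℕ.* o ℕ.≤ e → m ℕ.* p ℕ.≤ e → n ℕ.* o ℕ.≤ e → n ℕ.* p ℕ.≤ e →
                (m ⊔ n) ℕ.* (o ⊔ p) ℕ.≤ e
⊔-product-lub m n o p mo mp n*o np = ℕₚ.≤-trans (ℕₚ.≤-reflexive (ℕₚ.*-distribʳ-⊔ (o ⊔ p) m n))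
  (ℕₚ.⊔-lub (ℕₚ.≤-trans (ℕₚ.≤-reflexive (ℕₚ.*-distribˡ-⊔ m o p)) (ℕₚ.⊔-lub mo mp))
            (ℕₚ.≤-trans (ℕₚ.≤-reflexive (ℕₚ.*-distribˡ-⊔ n o p)) (ℕₚ.⊔-lub n*o np)))

module _ (γ : SL₂ℤ) where
  open SL₂ℤ γ

  ∣a∣≤∣γ∣ : ∣ a ∣ ℕ.≤ ∣ γ ∣ₘ
  ∣a∣≤∣γ∣ = ℕₚ.≤-trans (ℕₚ.m≤m⊔n ∣ a ∣ ∣ b ∣) (ℕₚ.m≤m⊔n (∣ a ∣ ⊔ ∣ b ∣) (∣ c ∣ ⊔ ∣ d ∣))

  ∣b∣≤∣γ∣ : ∣ b ∣ ℕ.≤ ∣ γ ∣ₘ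
  ∣b∣≤∣γ∣ = ℕₚ.≤-trans (ℕₚ.m≤n⊔m ∣ a ∣ ∣ b ∣) (ℕₚ.m≤m⊔n (∣ a ∣ ⊔ ∣ b ∣) (∣ c ∣ ⊔ ∣ d ∣))

  ∣c∣≤∣γ∣ : ∣ c ∣ ℕ.≤ ∣ γ ∣ₘ
  ∣c∣≤∣γ∣ = ℕₚ.≤-trans (ℕₚ.m≤m⊔n ∣ c ∣ ∣ d ∣) (ℕₚ.m≤n⊔m (∣ a ∣ ⊔ ∣ b ∣) (∣ c ∣ ⊔ ∣ d ∣))

  ∣d∣≤∣γ∣ : ∣ d ∣ ℕ.≤ ∣ γ ∣ₘ
  ∣d∣≤∣γ∣ = ℕₚ.≤-trans (ℕₚ.m≤n⊔m ∣ c ∣ ∣ d ∣) (ℕₚ.m≤n⊔m (∣ a ∣ ⊔ ∣ b ∣) (∣ c ∣ ⊔ ∣ d ∣))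

-- The largest entry of the rank-one difference v ⊗ B is the product of the two norms; the triangle
-- inequality is applied to each of its four entries.
∣product∣-step : ∀ p r p′ r′ a₁ a₂ b₁ b₂ det-v det-B l → let γ = product p r p′ r′ a₁ a₂ b₁ b₂ det-v det-B in
                 ‖ p , r ‖ℤ ℕ.* ‖ b₁ , b₂ ‖ℤ ℕ.≤ ∣ γ (l ℤ.+ + 1) ∣ₘ ℕ.+ ∣ γ l ∣ₘ
∣product∣-step p r p′ r′ a₁ a₂ b₁ b₂ det-v det-B l = ⊔-product-lub (∣ p ∣) (∣ r ∣) (∣ b₁ ∣) (∣ b₂ ∣)
  (ℕₚ.≤-trans (entry-step p p′ a₁ b₁ l) (ℕₚ.+-mono-≤ (∣a∣≤∣γ∣ γ₁) (∣a∣≤∣γ∣ γ₀)))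
  (ℕₚ.≤-trans (entry-step p p′ a₂ b₂ l) (ℕₚ.+-mono-≤ (∣b∣≤∣γ∣ γ₁) (∣b∣≤∣γ∣ γ₀)))
  (ℕₚ.≤-trans (entry-step r r′ a₁ b₁ l) (ℕₚ.+-mono-≤ (∣c∣≤∣γ∣ γ₁) (∣c∣≤∣γ∣ γ₀)))
  (ℕₚ.≤-trans (entry-step r r′ a₂ b₂ l) (ℕₚ.+-mono-≤ (∣d∣≤∣γ∣ γ₁) (∣d∣≤∣γ∣ γ₀)))
  where
  γ₁ = product p r p′ r′ a₁ a₂ b₁ b₂ det-v det-B (l ℤ.+ + 1)
  γ₀ = product p r p′ r′ a₁ a₂ b₁ b₂ det-v det-B l

∣i∣-sign : ∀ i → ∃ λ σ → + ∣ i ∣ ≡ σ ℤ.* i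
∣i∣-sign (+ n)    = + 1 , ≡.sym (ℤₚ.*-identityˡ (+ n))
∣i∣-sign -[1+ n ] = ℤ.- + 1 , ≡.sym (ℤₚ.-1*i≡-i -[1+ n ])

-- Division by the gcd, which is nonzero because b is; this is why it can be written `suc g`. The
-- Bézout coefficients of |a| and |b|, multiplied by the signs of a and b, complete (p , r) to
-- determinant 1.
primitive-direction : ∀ a b → b ≢ + 0 → ∃ λ p → ∃ λ r → ∃ λ p′ → ∃ λ r′ → ∃ λ g →
                      p ℤ.* r′ ℤ.- r ℤ.* p′ ≡ + 1 × a ≡ p ℤ.* + suc g × b ≡ r ℤ.* + suc g
primitive-direction a b b≢0 = by (gcd ∣ a ∣ ∣ b ∣)
  (ℤ.∣ᵤ⇒∣ {k = + gcd ∣ a ∣ ∣ b ∣} {i = a} (gcd[m,n]∣m (∣ a ∣) (∣ b ∣)))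
  (ℤ.∣ᵤ⇒∣ {k = + gcd ∣ a ∣ ∣ b ∣} {i = b} (gcd[m,n]∣n (∣ a ∣) (∣ b ∣)))
  (Bézout.identity (gcd-GCD (∣ a ∣) (∣ b ∣)))
  where
  σ = proj₁ (∣i∣-sign a)
  τ = proj₁ (∣i∣-sign b)
  unit : ∀ g u v p r → + suc g ≡ u ℤ.* (p ℤ.* + suc g) ℤ.- v ℤ.* (r ℤ.* + suc g) → p ℤ.* u ℤ.- r ℤ.* v ≡ + 1
  unit g u v p r e = ℤₚ.*-cancelʳ-≡ (p ℤ.* u ℤ.- r ℤ.* v) (+ 1) (+ suc g) (≡.trans
    (ℤ-solve 5 (λ g u v p r → (p :*ℤ u :-ℤ r :*ℤ v) :*ℤ g :=ℤ u :*ℤ (p :*ℤ g) :-ℤ v :*ℤ (r :*ℤ g)) ≡.refl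
        (+ suc g) u v p r)
    (≡.trans (≡.sym e) (≡.sym (ℤₚ.*-identityˡ (+ suc g)))))
  cast : ∀ d x y m n i j ρ π → + m ≡ ρ ℤ.* i → + n ≡ π ℤ.* j → d ℕ.+ y ℕ.* n ≡ x ℕ.* m →
         + d ≡ (+ x ℤ.* ρ) ℤ.* i ℤ.- (+ y ℤ.* π) ℤ.* j
  cast d x y m n i j ρ π m≡ n≡ e = ≡.trans
    (ℤ-solve 2 (λ d z → d :=ℤ d :+ℤ z :-ℤ z) ≡.refl (+ d) (+ (y ℕ.* n)))
    (≡.cong₂ ℤ._-_ (≡.trans (≡.cong +_ e) (scale x m i ρ m≡)) (scale y n j π n≡))
    where
    scale : ∀ x m i ρ → + m ≡ ρ ℤ.* i → + (x ℕ.* m) ≡ (+ x ℤ.* ρ) ℤ.* i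
    scale x m i ρ m≡ = ≡.trans (ℤₚ.pos-* x m) (≡.trans (≡.cong (+ x ℤ.*_) m≡) (≡.sym (ℤₚ.*-assoc (+ x) ρ i)))
  by : ∀ d → + d ℤ.∣ a → + d ℤ.∣ b → Bézout.Identity d ∣ a ∣ ∣ b ∣ → ∃ λ p → ∃ λ r → ∃ λ p′ → ∃ λ r′ → ∃ λ g →
       p ℤ.* r′ ℤ.- r ℤ.* p′ ≡ + 1 × a ≡ p ℤ.* + suc g × b ≡ r ℤ.* + suc g
  by zero _ (ℤ.divides r b≡r0) _ = contradiction (≡.trans b≡r0 (ℤₚ.*-zeroʳ r)) b≢0
  by (suc g) (ℤ.divides p a≡) (ℤ.divides r b≡) (Bézout.+- x y e) =
    p , r , + y ℤ.* τ , + x ℤ.* σ , g , unit g (+ x ℤ.* σ) (+ y ℤ.* τ) p r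
      (≡.trans (cast (suc g) x y (∣ a ∣) (∣ b ∣) a b σ τ (proj₂ (∣i∣-sign a)) (proj₂ (∣i∣-sign b)) e)
        (≡.cong₂ (λ s t → (+ x ℤ.* σ) ℤ.* s ℤ.- (+ y ℤ.* τ) ℤ.* t) a≡ b≡)) , a≡ , b≡
  by (suc g) (ℤ.divides p a≡) (ℤ.divides r b≡) (Bézout.-+ x y e) =
    p , r , ℤ.- (+ y ℤ.* τ) , ℤ.- (+ x ℤ.* σ) , g , unit g (ℤ.- (+ x ℤ.* σ)) (ℤ.- (+ y ℤ.* τ)) p r
      (≡.trans (cast (suc g) y x (∣ b ∣) (∣ a ∣) b a τ σ (proj₂ (∣i∣-sign b)) (proj₂ (∣i∣-sign a)) e)
        (≡.trans (≡.cong₂ (λ s t → (+ y ℤ.* τ) ℤ.* t ℤ.- (+ x ℤ.* σ) ℤ.* s) a≡ b≡)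
          (ℤ-solve 4 (λ u v s t → v :*ℤ t :-ℤ u :*ℤ s :=ℤ (:-ℤ′ u) :*ℤ s :-ℤ (:-ℤ′ v) :*ℤ t) ≡.refl
              (+ x ℤ.* σ) (+ y ℤ.* τ) (p ℤ.* + suc g) (r ℤ.* + suc g)))) , a≡ , b≡

-- The reason (ii) holds for every fraction representing the slope: reducing it to lowest terms does
-- not increase the norm that enters the constant.
‖‖-*-≤ : ∀ p r g → ‖ p , r ‖ℤ ℕ.≤ ‖ p ℤ.* + suc g , r ℤ.* + suc g ‖ℤ
‖‖-*-≤ p r g = ℕₚ.⊔-mono-≤ (absorb p) (absorb r)
  where
  absorb : ∀ p → ∣ p ∣ ℕ.≤ ∣ p ℤ.* + suc g ∣
  absorb p = ℕₚ.≤-trans (ℕₚ.m≤m*n (∣ p ∣) (suc g)) (ℕₚ.≤-reflexive (≡.sym (ℤₚ.abs-* p (+ suc g))))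

det⇒‖‖≥1 : ∀ p r p′ r′ → p ℤ.* r′ ℤ.- r ℤ.* p′ ≡ + 1 → 1 ℕ.≤ ‖ p , r ‖ℤ
det⇒‖‖≥1 (+ zero)  (+ zero)  p′ r′ ()
det⇒‖‖≥1 (+ suc _) r p′ r′ _ = ℕₚ.≤-trans (ℕ.s≤s ℕ.z≤n) (ℕₚ.m≤m⊔n _ (∣ r ∣))
det⇒‖‖≥1 -[1+ _ ]  r p′ r′ _ = ℕₚ.≤-trans (ℕ.s≤s ℕ.z≤n) (ℕₚ.m≤m⊔n _ (∣ r ∣))
det⇒‖‖≥1 p@(+ zero) (+ suc _) p′ r′ _ = ℕ.s≤s ℕ.z≤n
det⇒‖‖≥1 p@(+ zero) -[1+ _ ] p′ r′ _ = ℕ.s≤s ℕ.z≤n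

-- A matrix larger than every member of a list is outside the list. All three existence statements
-- are therefore proved with a prescribed lower bound `G` for the norm.
unbounded⇒infinite : ∀ {p} {P : Pred SL₂ℤ p} → (∀ G → ∃ λ γ → G ℕ.≤ ∣ γ ∣ₘ × P γ) → InfinitelyMany P
unbounded⇒infinite unbounded γs =
  let γ , large , Pγ = unbounded (suc (height γs)) in
  γ , Pγ , λ γ∈γs → ℕₚ.<-irrefl ≡.refl (ℕₚ.≤-trans large (≤height γs γ∈γs))
  where
  height : List SL₂ℤ → ℕ
  height []       = 0
  height (γ ∷ γs) = ∣ γ ∣ₘ ⊔ height γs
  ≤height : ∀ γs {γ} → γ ∈ γs → ∣ γ ∣ₘ ℕ.≤ height γs
  ≤height (γ ∷ γs) (here ≡.refl) = ℕₚ.m≤m⊔n _ _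
  ≤height (γ ∷ γs) (there γ∈γs)  = ℕₚ.≤-trans (≤height γs γ∈γs) (ℕₚ.m≤n⊔m (∣ γ ∣ₘ) _)

-- Complete ordered fields

module OrderedField {c ℓ} (R : CompleteOrderedField c ℓ) where

  open Plane R
  open CommutativeRing commutativeRing public
    using (ring; semiring; refl; sym; trans; +-cong; +-congˡ; +-congʳ; *-cong; *-congˡ; *-congʳ
          ; +-assoc; +-comm; *-assoc; *-comm; +-identityˡ; +-identityʳ; *-identityˡ; *-identityʳ
          ; distribˡ; distribʳ; zeroˡ; zeroʳ; -‿cong; -‿inverseˡ; -‿inverseʳ)
  open RingProperties ring using (-‿distribˡ-*; -‿distribʳ-*; -‿involutive; -0#≈0#; -‿+-comm)
  module < = StrictTotalOrder strictTotalOrder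
  module ≤ = TotalOrder totalOrder
  open OrderReasoning <.strictPartialOrder
  open NaturalMax totalOrder public
    using (⊔-cong; ⊔-sel; x≤x⊔y; x≤y⊔x; ⊔-lub)

  fromℤ-⊖ : ∀ m n → fromℤ (m ℤ.⊖ n) ≈ fromℕ m - fromℕ n
  fromℤ-⊖ m zero = sym (trans (+-congˡ -0#≈0#) (+-identityʳ _))
  fromℤ-⊖ zero (suc n) = sym (+-identityˡ _)
  fromℤ-⊖ (suc m) (suc n) = begin-equality
    fromℤ (suc m ℤ.⊖ suc n)                   ≡⟨ ≡.cong fromℤ (ℤₚ.[1+m]⊖[1+n]≡m⊖n m n) ⟩
    fromℤ (m ℤ.⊖ n)                           ≈⟨ fromℤ-⊖ m n ⟩
    fromℕ m - fromℕ n                         ≈⟨ +-congʳ (+-identityʳ _) ⟨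
    fromℕ m + 0# - fromℕ n                    ≈⟨ +-congʳ (+-congˡ (-‿inverseʳ 1#)) ⟨
    fromℕ m + (1# - 1#) - fromℕ n             ≈⟨ +-congʳ (+-assoc _ _ _) ⟨
    fromℕ m + 1# - 1# - fromℕ n               ≈⟨ +-congʳ (+-congʳ (+-comm _ _)) ⟩
    1# + fromℕ m - 1# - fromℕ n               ≈⟨ +-assoc _ _ _ ⟩
    1# + fromℕ m + (- 1# - fromℕ n)           ≈⟨ +-congˡ (-‿+-comm _ _) ⟩
    1# + fromℕ m - (1# + fromℕ n)             ∎

  fromℤ-neg : ∀ i → fromℤ (ℤ.- i) ≈ - fromℤ i
  fromℤ-neg (+ zero)    = sym -0#≈0#
  fromℤ-neg (+ suc n)   = refl
  fromℤ-neg -[1+ n ]    = sym (-‿involutive _)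

  fromℤ-+ : ∀ i j → fromℤ (i ℤ.+ j) ≈ fromℤ i + fromℤ j
  fromℤ-+ (+ m)    (+ n)    = MonoidMult.×-homo-+ (CommutativeRing.+-monoid commutativeRing) 1# m n
  fromℤ-+ (+ m)    -[1+ n ] = fromℤ-⊖ m (suc n)
  fromℤ-+ -[1+ m ] (+ n)    = trans (fromℤ-⊖ n (suc m)) (+-comm _ _)
  fromℤ-+ -[1+ m ] -[1+ n ] = begin-equality
    - fromℕ (suc (suc (m ℕ.+ n)))   ≡⟨ ≡.cong (λ k → - fromℕ (suc k)) (ℕₚ.+-suc m n) ⟨
    - fromℕ (suc m ℕ.+ suc n)       ≈⟨ -‿cong (fromℤ-+ (+ suc m) (+ suc n)) ⟩
    - (fromℕ (suc m) + fromℕ (suc n)) ≈⟨ -‿+-comm _ _ ⟨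
    - fromℕ (suc m) - fromℕ (suc n) ∎

  fromℕ-* : ∀ m n → fromℕ (m ℕ.* n) ≈ fromℕ m * fromℕ n
  fromℕ-* = SemiringMult.×1-homo-* semiring

  fromℤ-* : ∀ i j → fromℤ (i ℤ.* j) ≈ fromℤ i * fromℤ j
  fromℤ-* i (+ n) = nonneg i
    where
    nonneg : ∀ i → fromℤ (i ℤ.* + n) ≈ fromℤ i * fromℕ n
    nonneg (+ m) = trans (≤.Eq.reflexive (≡.cong fromℤ (≡.sym (ℤₚ.pos-* m n)))) (fromℕ-* m n)
    nonneg -[1+ m ] = begin-equality
      fromℤ (-[1+ m ] ℤ.* + n)           ≡⟨ ≡.cong fromℤ (ℤₚ.neg-distribˡ-* (+ suc m) (+ n)) ⟨
      fromℤ (ℤ.- (+ suc m ℤ.* + n))      ≈⟨ fromℤ-neg (+ suc m ℤ.* + n) ⟩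
      - fromℤ (+ suc m ℤ.* + n)          ≈⟨ -‿cong (nonneg (+ suc m)) ⟩
      - (fromℕ (suc m) * fromℕ n)        ≈⟨ -‿distribˡ-* _ _ ⟩
      - fromℕ (suc m) * fromℕ n          ∎
  fromℤ-* i -[1+ n ] = begin-equality
    fromℤ (i ℤ.* -[1+ n ])         ≡⟨ ≡.cong fromℤ (ℤₚ.neg-distribʳ-* i (+ suc n)) ⟨
    fromℤ (ℤ.- (i ℤ.* + suc n))    ≈⟨ fromℤ-neg (i ℤ.* + suc n) ⟩
    - fromℤ (i ℤ.* + suc n)        ≈⟨ -‿cong (fromℤ-* i (+ suc n)) ⟩
    - (fromℤ i * fromℕ (suc n))    ≈⟨ -‿distribʳ-* _ _ ⟩
    fromℤ i * - fromℕ (suc n)      ∎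

  -- Gives the ring solver integer coefficients, so that numerals such as `con (+ 12)` can be
  -- computed with and match `fromℕ 12` in the goals.
  fromℤ-morphism : ℤ.+-*-rawRing -Raw-AlmostCommutative⟶ fromCommutativeRing commutativeRing
  fromℤ-morphism = record
    { ⟦_⟧    = fromℤ
    ; +-homo = fromℤ-+
    ; *-homo = fromℤ-*
    ; -‿homo = fromℤ-neg
    ; 0-homo = refl
    ; 1-homo = +-identityʳ 1#
    }

  fromℤ-≟ : WeaklyDecidable (Induced-equivalence fromℤ-morphism)
  fromℤ-≟ i j with i ℤₚ.≟ j
  ... | yes ≡.refl = just refl
  ... | no  _      = nothing

  open RingSolver ℤ.+-*-rawRing (fromCommutativeRing commutativeRing) fromℤ-morphism fromℤ-≟ public
    using (solve; con; _:=_; _:+_; _:*_; _:-_; :-_; _:^_)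

  ≤⇒≯ : ∀ {x y} → x ≤ y → ¬ (y < x)
  ≤⇒≯ (inj₁ x<y) y<x = <.asym x<y y<x
  ≤⇒≯ (inj₂ x≈y) y<x = <.irrefl (sym x≈y) y<x

  <-≤-trans : ∀ {x y z} → x < y → y ≤ z → x < z
  <-≤-trans x<y (inj₁ y<z) = <.trans x<y y<z
  <-≤-trans x<y (inj₂ y≈z) = proj₁ <.<-resp-≈ y≈z x<y

  ≤-<-trans : ∀ {x y z} → x ≤ y → y < z → x < z
  ≤-<-trans (inj₁ x<y) y<z = <.trans x<y y<z
  ≤-<-trans (inj₂ x≈y) y<z = proj₂ <.<-resp-≈ (sym x≈y) y<z

  _≤?<_ : ∀ x y → x ≤ y ⊎ y < x
  x ≤?< y with <.compare x y
  ... | tri< x<y _ _ = inj₁ (inj₁ x<y)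
  ... | tri≈ _ x≈y _ = inj₁ (inj₂ x≈y)
  ... | tri> _ _ y<x = inj₂ y<x

  _<?≤_ : ∀ x y → x < y ⊎ y ≤ x
  x <?≤ y = [ inj₂ , inj₁ ]′ (y ≤?< x)

  <⇒≉ : ∀ {x} → 0# < x → x ≉ 0#
  <⇒≉ 0<x x≈0 = <.irrefl (sym x≈0) 0<x

  +-monoʳ-≤ : ∀ z {x y} → x ≤ y → z + x ≤ z + y
  +-monoʳ-≤ z (inj₁ x<y) = inj₁ (+-monoʳ-< z x<y)
  +-monoʳ-≤ z (inj₂ x≈y) = inj₂ (+-congˡ x≈y)

  infixl 6 _⊞_
  infixl 7 _⊠_

  _⊞_ : ∀ {x y} → 0# ≤ x → 0# ≤ y → 0# ≤ x + y
  _⊞_ {x} {y} 0≤x 0≤y = begin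
    0#      ≤⟨ 0≤x ⟩
    x       ≈⟨ +-identityʳ x ⟨
    x + 0#  ≤⟨ +-monoʳ-≤ x 0≤y ⟩
    x + y   ∎

  _⊠_ : ∀ {x y} → 0# ≤ x → 0# ≤ y → 0# ≤ x * y
  inj₁ 0<x ⊠ inj₁ 0<y = inj₁ (*-pos 0<x 0<y)
  inj₁ 0<x ⊠ inj₂ 0≈y = inj₂ (trans (sym (zeroʳ _)) (*-congˡ 0≈y))
  inj₂ 0≈x ⊠ _        = inj₂ (trans (sym (zeroˡ _)) (*-congʳ 0≈x))

  -- Most inequalities x ≤ y below are obtained by writing y - x as a sum of products of
  -- nonnegative terms, an identity left to the ring solver.
  ≤-by : ∀ {d x y} → 0# ≤ d → x + d ≈ y → x ≤ y
  ≤-by {d} {x} {y} 0≤d x+d≈y = begin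
    x      ≈⟨ +-identityʳ x ⟨
    x + 0# ≤⟨ +-monoʳ-≤ x 0≤d ⟩
    x + d  ≈⟨ x+d≈y ⟩
    y      ∎

  <-by : ∀ {d x y} → 0# < d → x + d ≈ y → x < y
  <-by {d} {x} {y} 0<d x+d≈y = begin-strict
    x      ≈⟨ +-identityʳ x ⟨
    x + 0# <⟨ +-monoʳ-< x 0<d ⟩
    x + d  ≈⟨ x+d≈y ⟩
    y      ∎

  gap : ∀ {x y} → x ≤ y → 0# ≤ y - x
  gap {x} {y} x≤y = begin
    0#        ≈⟨ -‿inverseˡ x ⟨
    - x + x   ≤⟨ +-monoʳ-≤ (- x) x≤y ⟩
    - x + y   ≈⟨ +-comm _ _ ⟩
    y - x     ∎

  gap-< : ∀ {x y} → x < y → 0# < y - x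
  gap-< {x} {y} x<y = begin-strict
    0#        ≈⟨ -‿inverseˡ x ⟨
    - x + x   <⟨ +-monoʳ-< (- x) x<y ⟩
    - x + y   ≈⟨ +-comm _ _ ⟩
    y - x     ∎

  +-mono-≤ : ∀ {x y u v} → x ≤ y → u ≤ v → x + u ≤ y + v
  +-mono-≤ {x} {y} {u} {v} x≤y u≤v = ≤-by (gap x≤y ⊞ gap u≤v)
    (solve 4 (λ x y u v → (x :+ u) :+ ((y :- x) :+ (v :- u)) := y :+ v) refl x y u v)

  *-mono-≤ : ∀ {x y u v} → 0# ≤ x → x ≤ y → 0# ≤ u → u ≤ v → x * u ≤ y * v
  *-mono-≤ {x} {y} {u} {v} 0≤x x≤y 0≤u u≤v =
    ≤-by (0≤x ⊠ gap u≤v ⊞ gap x≤y ⊠ ≤.trans 0≤u u≤v)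
    (solve 4 (λ x y u v → x :* u :+ (x :* (v :- u) :+ (y :- x) :* v) := y :* v) refl x y u v)

  square-nonneg : ∀ x → 0# ≤ x * x
  square-nonneg x with 0# ≤?< x
  ... | inj₁ 0≤x = 0≤x ⊠ 0≤x
  ... | inj₂ x<0 = ≤.trans (0≤-x ⊠ 0≤-x)
      (≤.reflexive (solve 1 (λ x → (con (+ 0) :- x) :* (con (+ 0) :- x) := x :* x) refl x))
    where 0≤-x = gap (inj₁ x<0)

  0<1 : 0# < 1#
  0<1 with 0# ≤?< 1#
  ... | inj₁ (inj₁ 0<1) = 0<1
  ... | inj₁ (inj₂ 0≈1) = contradiction 0≈1 0≉1
  ... | inj₂ 1<0 = contradiction 1<0 (≤⇒≯ (≤.trans (square-nonneg 1#) (≤.reflexive (*-identityˡ 1#))))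

  0≤fromℕ : ∀ n → 0# ≤ fromℕ n
  0≤fromℕ zero    = ≤.refl
  0≤fromℕ (suc n) = inj₁ 0<1 ⊞ 0≤fromℕ n

  fromℕ-mono : ∀ {m n} → m ℕ.≤ n → fromℕ m ≤ fromℕ n
  fromℕ-mono {n = n} ℕ.z≤n = 0≤fromℕ n
  fromℕ-mono (ℕ.s≤s m≤n) = +-monoʳ-≤ 1# (fromℕ-mono m≤n)

  fromℕ-pos : ∀ {n} → 1 ℕ.≤ n → 0# < fromℕ n
  fromℕ-pos {n} 1≤n = begin-strict
    0#       <⟨ 0<1 ⟩
    1#       ≈⟨ +-identityʳ 1# ⟨
    fromℕ 1  ≤⟨ fromℕ-mono 1≤n ⟩
    fromℕ n  ∎

  fromℤ-injective-0 : ∀ i → fromℤ i ≈ 0# → i ≡ + 0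
  fromℤ-injective-0 (+ zero)  _ = ≡.refl
  fromℤ-injective-0 (+ suc n) e = contradiction e (<⇒≉ (fromℕ-pos {suc n} (ℕ.s≤s ℕ.z≤n)))
  fromℤ-injective-0 -[1+ n ]  e = contradiction
    (trans (sym (-‿involutive _)) (trans (-‿cong e) -0#≈0#)) (<⇒≉ (fromℕ-pos {suc n} (ℕ.s≤s ℕ.z≤n)))

  ⁻¹-pos : ∀ {x} → 0# < x → 0# < x ⁻¹
  ⁻¹-pos {x} 0<x with 0# <?≤ (x ⁻¹)
  ... | inj₁ 0<i = 0<i
  ... | inj₂ i≤0 = contradiction 0<1 (≤⇒≯ (≤-by (inj₁ 0<x ⊠ gap i≤0)
    (trans (+-congʳ (sym (⁻¹-inverseʳ (<⇒≉ 0<x))))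
      (solve 2 (λ x i → x :* i :+ x :* (con (+ 0) :- i) := con (+ 0)) refl x (x ⁻¹)))))

  /-*-cancel : ∀ {x} y → y ≉ 0# → x / y * y ≈ x
  /-*-cancel y y≉0 = trans (*-assoc _ _ _) (trans (*-congˡ (trans (*-comm _ _) (⁻¹-inverseʳ y≉0)))
      (*-identityʳ _))

  *-cancelʳ-≈ : ∀ {x y z} → z ≉ 0# → x * z ≈ y * z → x ≈ y
  *-cancelʳ-≈ {x} {y} {z} z≉0 xz≈yz = begin-equality
    x               ≈⟨ unit x ⟨
    x * z * z ⁻¹    ≈⟨ *-congʳ xz≈yz ⟩
    y * z * z ⁻¹    ≈⟨ unit y ⟩
    y               ∎
    where
    unit : ∀ t → t * z * z ⁻¹ ≈ t
    unit t = trans (*-assoc _ _ _) (trans (*-congˡ (⁻¹-inverseʳ z≉0)) (*-identityʳ t))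

  *-cancelʳ-≤ : ∀ {x y z} → 0# < z → x * z ≤ y * z → x ≤ y
  *-cancelʳ-≤ {x} {y} {z} 0<z xz≤yz with x ≤?< y
  ... | inj₁ x≤y = x≤y
  ... | inj₂ y<x = contradiction (<-by (*-pos (gap-< y<x) 0<z)
    (solve 3 (λ x y z → y :* z :+ (x :- y) :* z := x :* z) refl x y z)) (≤⇒≯ xz≤yz)

  *≤⇒≤/ : ∀ {x y z} → 0# < z → x * z ≤ y → x ≤ y / z
  *≤⇒≤/ {x} {y} {z} 0<z xz≤y =
    *-cancelʳ-≤ 0<z (≤.trans xz≤y (≤.reflexive (sym (/-*-cancel z (<⇒≉ 0<z)))))

  abs-lub : ∀ {x e} → x ≤ e → - x ≤ e → abs x ≤ e
  abs-lub = ⊔-lub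

  x≤∣x∣ : ∀ x → x ≤ abs x
  x≤∣x∣ x = x≤x⊔y x (- x)

  -x≤∣x∣ : ∀ x → - x ≤ abs x
  -x≤∣x∣ x = x≤y⊔x x (- x)

  0≤∣x∣ : ∀ x → 0# ≤ abs x
  0≤∣x∣ x with 0# ≤?< x
  ... | inj₁ 0≤x = ≤.trans 0≤x (x≤∣x∣ x)
  ... | inj₂ x<0 = ≤.trans (gap (inj₁ x<0)) (≤.trans (≤.reflexive (+-identityˡ _)) (-x≤∣x∣ x))

  abs-cong : ∀ {x y} → x ≈ y → abs x ≈ abs y
  abs-cong e = ⊔-cong e (-‿cong e)

  abs-nonneg : ∀ {x} → 0# ≤ x → abs x ≈ x
  abs-nonneg {x} 0≤x = ≤.antisym (abs-lub ≤.refl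
    (≤-by (0≤x ⊞ 0≤x) (solve 1 (λ x → (:- x) :+ (x :+ x) := x) refl x))) (x≤∣x∣ x)

  abs-neg : ∀ x → abs (- x) ≈ abs x
  abs-neg x = ≤.antisym (abs-lub (-x≤∣x∣ x) (≤.trans (≤.reflexive (-‿involutive x)) (x≤∣x∣ x)))
    (abs-lub (≤.trans (≤.reflexive (sym (-‿involutive x))) (-x≤∣x∣ (- x))) (x≤∣x∣ (- x)))

  ∣x∣-sign : ∀ x → ∃ λ τ → ∣ τ ∣ ≡ 1 × fromℤ τ * x ≈ abs x
  ∣x∣-sign x with 0# ≤?< x
  ... | inj₁ 0≤x = + 1 , ≡.refl , trans (solve 1 (λ x → con (+ 1) :* x := x) refl x) (sym (abs-nonneg 0≤x))
  ... | inj₂ x<0 = -[1+ 0 ] , ≡.refl ,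
    trans (solve 1 (λ x → con (-[1+ 0 ]) :* x := :- x) refl x)
     (trans (sym (abs-nonneg (≤.trans (gap (inj₁ x<0)) (≤.reflexive (+-identityˡ _))))) (abs-neg x))

  abs-sel : ∀ x → abs x ≈ x ⊎ abs x ≈ - x
  abs-sel x = ⊔-sel x (- x)

  abs-* : ∀ x y → abs (x * y) ≈ abs x * abs y
  abs-* x y with abs-sel x | abs-sel y
  ... | p | q = begin-equality
    abs (x * y)            ≈⟨ signed p q ⟩
    abs (abs x * abs y)    ≈⟨ abs-nonneg (0≤∣x∣ x ⊠ 0≤∣x∣ y) ⟩
    abs x * abs y          ∎
    where
    signed : abs x ≈ x ⊎ abs x ≈ - x → abs y ≈ y ⊎ abs y ≈ - y → abs (x * y) ≈ abs (abs x * abs y)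
    signed (inj₁ p) (inj₁ q) = abs-cong (*-cong (sym p) (sym q))
    signed (inj₁ p) (inj₂ q) = trans (sym (abs-neg _)) (abs-cong (trans (-‿distribʳ-* _ _)
        (*-cong (sym p) (sym q))))
    signed (inj₂ p) (inj₁ q) = trans (sym (abs-neg _)) (abs-cong (trans (-‿distribˡ-* _ _)
        (*-cong (sym p) (sym q))))
    signed (inj₂ p) (inj₂ q) = abs-cong (trans (solve 2 (λ x y → x :* y := (:- x) :* (:- y)) refl x y)
        (*-cong (sym p) (sym q)))

  abs-+ : ∀ x y → abs (x + y) ≤ abs x + abs y
  abs-+ x y = abs-lub (+-mono-≤ (x≤∣x∣ x) (x≤∣x∣ y))
    (≤.trans (≤.reflexive (sym (-‿+-comm x y))) (+-mono-≤ (-x≤∣x∣ x) (-x≤∣x∣ y)))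

  abs-fromℤ : ∀ i → abs (fromℤ i) ≈ fromℕ ∣ i ∣
  abs-fromℤ (+ n)    = abs-nonneg (0≤fromℕ n)
  abs-fromℤ -[1+ n ] = trans (abs-neg _) (abs-nonneg (0≤fromℕ (suc n)))

  -- Completeness decides Q through the supremum of {0} ∪ {1 | Q}.
  excluded-middle : (Q : Set (c ⊔ˡ ℓ)) → Dec Q
  excluded-middle Q = decide (0# <?≤ s)
    where
    P : ℝ → Set (c ⊔ˡ ℓ)
    P t = Lift (c ⊔ˡ ℓ) (t ≤ 0#) ⊎ (Lift (c ⊔ˡ ℓ) (t ≤ 1#) × Q)
    bounded : ∃ (UpperBound P)
    bounded = 1# , λ { (inj₁ (lift t≤0)) → ≤.trans t≤0 (inj₁ 0<1) ; (inj₂ (lift t≤1 , _)) → t≤1 }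
    supremum = complete P (0# , inj₁ (lift ≤.refl)) bounded
    s = proj₁ supremum
    decide : 0# < s ⊎ s ≤ 0# → Dec Q
    decide (inj₁ 0<s) with proj₂ (proj₂ supremum) 0<s
    ... | _ , inj₁ (lift t≤0) , 0<t = contradiction 0<t (≤⇒≯ t≤0)
    ... | _ , inj₂ (_ , q)    , _   = yes q
    decide (inj₂ s≤0) = no λ q →
      ≤⇒≯ (≤.trans (proj₁ (proj₂ supremum) (inj₂ (lift ≤.refl , q))) s≤0) 0<1

  -- If r bounded all naturals, they would have a supremum s; some n exceeds s - 1, and n + 1 would
  -- exceed s.
  archimedean : ∀ r → ∃ λ n → r < fromℕ n
  archimedean r with excluded-middle (Lift (c ⊔ˡ ℓ) (∃ λ n → r < fromℕ n))
  ... | yes (lift p) = p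
  ... | no  ∄n = contradiction (n+1≤s , s<n+1) λ (p , q) → ≤⇒≯ p q
    where
    P : ℝ → Set (c ⊔ˡ ℓ)
    P t = Lift (c ⊔ˡ ℓ) (∃ λ n → t ≈ fromℕ n)
    below : ∀ n → fromℕ n ≤ r
    below n with fromℕ n ≤?< r
    ... | inj₁ n≤r = n≤r
    ... | inj₂ r<n = contradiction (lift (n , r<n)) ∄n
    supremum = complete P (0# , lift (0 , refl))
      (r , λ { (lift (n , t≈n)) → ≤.trans (≤.reflexive t≈n) (below n) })
    s = proj₁ supremum
    close = proj₂ (proj₂ supremum)
      (<-by {d = 1#} {s - 1#} {s} 0<1 (solve 2 (λ s u → s :- u :+ u := s) refl s 1#))
    n = proj₁ (lower (proj₁ (proj₂ close)))
    n+1≤s : fromℕ (suc n) ≤ s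
    n+1≤s = proj₁ (proj₂ supremum) (lift (suc n , refl))
    s<n+1 : s < fromℕ (suc n)
    s<n+1 = begin-strict
      s                 ≈⟨ solve 2 (λ s u → s := u :+ (s :- u)) refl s 1# ⟩
      1# + (s - 1#)     <⟨ +-monoʳ-< 1# (proj₂ (proj₂ close)) ⟩
      1# + proj₁ close  ≈⟨ +-congˡ (proj₂ (lower (proj₁ (proj₂ close)))) ⟩
      fromℕ (suc n)     ∎

  abstract
    archimedean-* : ∀ {b} r → 0# < b → ∃ λ n → r < fromℕ n * b
    archimedean-* {b} r 0<b with archimedean (r / b)
    ... | n , r/b<n = n , (begin-strict
      r          ≈⟨ /-*-cancel b (<⇒≉ 0<b) ⟨
      r / b * b  <⟨ <-by (*-pos (gap-< r/b<n) 0<b)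
                    (solve 3 (λ q n b → q :* b :+ (n :- q) :* b := n :* b) refl (r / b) (fromℕ n) b) ⟩
      fromℕ n * b ∎)

-- Consecutive convergents

module Convergents {c ℓ} (R : CompleteOrderedField c ℓ) where

  open Plane R
  open OrderedField R
  open OrderReasoning <.strictPartialOrder

  Form : ℤ → ℤ → ℝ² → ℝ
  Form a b (vec z₁ z₂) = fromℤ a * z₁ + fromℤ b * z₂

  fromℤ-≢0 : ∀ {i} → i ≢ + 0 → fromℤ i ≉ 0#
  fromℤ-≢0 i≢0 i≈0 = i≢0 (fromℤ-injective-0 _ i≈0)

  *-≈0ˡ : ∀ {x y} → y ≉ 0# → x * y ≈ 0# → x ≈ 0#
  *-≈0ˡ y≉0 xy≈0 = *-cancelʳ-≈ y≉0 (trans xy≈0 (sym (zeroˡ _)))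

  -- The rational `n ℚ./ suc k` is stored in lowest terms, so its numerator and denominator become n
  -- and `suc k` only after multiplication by their gcd `g`. Hence the comparison is made after
  -- multiplying by `D`, `z₂` and `g`, all nonzero.
  rational-slope : ∀ {z₁ z₂} n k → z₂ ≉ 0# → z₁ * fromℕ (suc k) ≈ fromℤ n * z₂ →
                   z₁ / z₂ ≈ fromℚ (n ℚ./ suc k)
  rational-slope {z₁} {z₂} n k z₂≉0 e = *-cancelʳ-≈ D≉0 (*-cancelʳ-≈ z₂≉0 (*-cancelʳ-≈ g≉0 (begin-equality
    z₁ / z₂ * D * z₂ * g    ≈⟨ solve 4 (λ s d z g → s :* d :* z :* g := (s :* z) :* (d :* g)) refl (z₁ / z₂)
        D z₂ g ⟩
    z₁ / z₂ * z₂ * (D * g)  ≈⟨ *-cong (/-*-cancel z₂ z₂≉0) Dg≈ ⟩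
    z₁ * fromℕ (suc k)      ≈⟨ e ⟩
    fromℤ n * z₂            ≈⟨ *-congʳ Ng≈ ⟨
    N * g * z₂              ≈⟨ *-congʳ (*-congʳ (/-*-cancel D D≉0)) ⟨
    N / D * D * g * z₂      ≈⟨ solve 4 (λ s d z g → s :* d :* g :* z := s :* d :* z :* g) refl (N / D) D z₂ g ⟩
    N / D * D * z₂ * g      ∎)))
    where
    q = n ℚ./ suc k
    N = fromℤ (↥ q)
    D = fromℤ (↧ q)
    g = fromℤ (ℤ.gcd n (+ suc k))
    Ng≈ : N * g ≈ fromℤ n
    Ng≈ = trans (sym (fromℤ-* (↥ q) (ℤ.gcd n (+ suc k)))) (≤.Eq.reflexive (≡.cong fromℤ (ℚₚ.↥-/ n (suc k))))
    Dg≈ : D * g ≈ fromℕ (suc k)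
    Dg≈ = trans (sym (fromℤ-* (↧ q) (ℤ.gcd n (+ suc k)))) (≤.Eq.reflexive (≡.cong fromℤ (ℚₚ.↧-/ n (suc k))))
    k+1≉0 : fromℕ (suc k) ≉ 0#
    k+1≉0 = fromℤ-≢0 {+ suc k} λ ()
    D≉0 : D ≉ 0#
    D≉0 D≈0 = k+1≉0 (trans (sym Dg≈) (trans (*-congʳ D≈0) (zeroˡ _)))
    g≉0 : g ≉ 0#
    g≉0 g≈0 = k+1≉0 (trans (sym Dg≈) (trans (*-congˡ g≈0) (zeroʳ _)))

  Independent : ℝ² → Set ℓ
  Independent z = ∀ a b → Form a b z ≈ 0# → a ≡ + 0 × b ≡ + 0

  -- A relation with a ≠ 0 would make the slope -b/a; one with a = 0 forces b = 0 because z₂ ≠ 0.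
  -- The sign of a is split off since a rational needs a positive denominator.
  irrational⇒independent : ∀ z → HasIrrationalSlope z → Independent z
  irrational⇒independent (vec z₁ z₂) (z₂≉0 , irr) (+ zero) b e = ≡.refl , fromℤ-injective-0 b
    (*-≈0ˡ z₂≉0 (trans (solve 3 (λ b z₁ z₂ → b :* z₂ := con (+ 0) :* z₁ :+ b :* z₂) refl (fromℤ b) z₁ z₂) e))
  irrational⇒independent (vec z₁ z₂) (z₂≉0 , irr) (+ suc k) b e = contradiction
    (ℤ.- b ℚ./ suc k , rational-slope (ℤ.- b) k z₂≉0 (trans
      (trans (solve 4 (λ a b z₁ z₂ → z₁ :* a := (a :* z₁ :+ b :* z₂) :- b :* z₂) refl (fromℕ (suc k))
          (fromℤ b) z₁ z₂)
      (trans (+-congʳ e) (solve 2 (λ b z₂ → con (+ 0) :- b :* z₂ := (:- b) :* z₂) refl (fromℤ b) z₂)))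
      (*-congʳ (sym (fromℤ-neg b))))) irr
  irrational⇒independent (vec z₁ z₂) (z₂≉0 , irr) -[1+ k ] b e = contradiction
    (b ℚ./ suc k , rational-slope b k z₂≉0
      (trans (solve 4 (λ a b z₁ z₂ → z₁ :* a := b :* z₂ :- ((:- a) :* z₁ :+ b :* z₂)) refl (fromℕ (suc k))
          (fromℤ b) z₁ z₂)
      (trans (+-congˡ (-‿cong e)) (solve 2 (λ b z₂ → b :* z₂ :- con (+ 0) := b :* z₂) refl (fromℤ b) z₂)))) irr

  abstract

    ⌊_/_⌋ : ∀ r {b} → 0# < b → 0# ≤ r → ∃ λ n → fromℕ n * b ≤ r × r < fromℕ (suc n) * b
    ⌊_/_⌋ r {b} 0<b 0≤r = between (archimedean-* r 0<b)
      where
      between : (∃ λ N → r < fromℕ N * b) → ∃ λ n → fromℕ n * b ≤ r × r < fromℕ (suc n) * b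
      between (N , r<Nb) =
        let n , _ , nb≤r , r<[n+1]b =
              crossing {P = λ n → fromℕ n * b ≤ r} {λ n → r < fromℕ n * b}
                (λ n → (fromℕ n * b) ≤?< r) 0 N (≤.trans (≤.reflexive (zeroˡ b)) 0≤r)
                (<-≤-trans r<Nb (*-mono-≤ (0≤fromℕ N) (fromℕ-mono (ℕₚ.m≤n⇒m≤1+n (ℕₚ.m≤m+n N 0))) (inj₁ 0<b)
                    ≤.refl))
        in n , nb≤r , r<[n+1]b

    ⌊_/_⌋ℤ : ∀ r {b} → 0# < b → ∃ λ l → fromℤ l * b ≤ r × r < fromℤ l * b + b
    ⌊_/_⌋ℤ r {b} 0<b = shift (archimedean-* (- r) 0<b)
      where
      fromℤ-- : ∀ n M → fromℤ (+ n ℤ.- + M) ≈ fromℕ n - fromℕ M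
      fromℤ-- n M = trans (fromℤ-+ (+ n) (ℤ.- + M)) (+-congˡ (fromℤ-neg (+ M)))
      shift : (∃ λ M → - r < fromℕ M * b) → ∃ λ l → fromℤ l * b ≤ r × r < fromℤ l * b + b
      shift (M , -r<Mb) = let n , lo , hi = ⌊_/_⌋ (r + fromℕ M * b) 0<b 0≤r+Mb in + n ℤ.- + M
        , ≤-by (gap lo) (trans (+-congʳ (*-congʳ (fromℤ-- n M)))
            (solve 4 (λ n M b r → (n :- M) :* b :+ (r :+ M :* b :- n :* b) := r) refl (fromℕ n) (fromℕ M) b r))
        , <-by (gap-< hi) (trans
            -- `fromℕ (suc n)` unfolds to `1# + fromℕ n`, while `con (+ 1)` stands for `1# + 0#`; so
            -- `1#` is passed as a variable `i`.
            (solve 5 (λ i n M b r → r :+ ((i :+ n) :* b :- (r :+ M :* b)) := (n :- M) :* b :+ i :* b) refl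
                1# (fromℕ n) (fromℕ M) b r)
            (+-cong (*-congʳ (sym (fromℤ-- n M))) (*-identityˡ b)))
        where
        0≤r+Mb : 0# ≤ r + fromℕ M * b
        0≤r+Mb = ≤.trans (gap (inj₁ -r<Mb)) (≤.reflexive (solve 2 (λ r m → m :- (:- r) := r :+ m) refl r
            (fromℕ M * b)))

-- Euclid's algorithm and its sequence of bases

module Sequence {c ℓ} (R : CompleteOrderedField c ℓ) where

  open Plane R
  open OrderedField R
  open Convergents R
  open OrderReasoning <.strictPartialOrder

  -- The rows are A = (a , b) and B = (a′ , b′). The values α and β are separate fields rather than
  -- absolute values of forms, so that one step's β is literally the next step's α. Signs are left
  -- open here and fixed later in `Oriented`.
  record Consecutive (z : ℝ²) : Set (c ⊔ˡ ℓ) where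
    field
      a b a′ b′ : ℤ
      α β       : ℝ
      det       : ∣ a ℤ.* b′ ℤ.- b ℤ.* a′ ∣ ≡ 1
      value     : abs (Form a b z) ≈ α
      value′    : abs (Form a′ b′ z) ≈ β
      0<β       : 0# < β
      β<α       : β < α
      size      : ‖ a , b ‖ℤ ℕ.≤ ‖ a′ , b′ ‖ℤ
      bound     : fromℕ ‖ a′ , b′ ‖ℤ * α ≤ ‖ z ‖

  -- Here u = |z₁| and w = |z₂|; the forms α and β are p u - q w and p′ u - q′ w up to
  -- opposite signs, so that in eq-w and eq-u all terms are nonnegative.
  record Euclid (u w : ℝ) (k : ℕ) : Set (c ⊔ˡ ℓ) where
    field
      p q p′ q′ : ℕ
      α β       : ℝ
      det       : ∣ + p ℤ.* + q′ ℤ.- + q ℤ.* + p′ ∣ ≡ 1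
      eq-w      : fromℕ p′ * α + fromℕ p * β ≈ w
      eq-u      : fromℕ q′ * α + fromℕ q * β ≈ u
      0<β       : 0# < β
      β<α       : β < α
      size      : p ⊔ q ℕ.≤ p′ ⊔ q′
      positive  : 1 ℕ.≤ p ⊔ q
      large     : k ℕ.≤ p′ ℕ.+ q′

  module _ {u w : ℝ} (0<w : 0# < w)
           (independent : ∀ p q → fromℕ p * u ≈ fromℕ q * w → p ≡ 0) where

    -- Division with remainder, α = nβ + β′, together with the continued fraction recursion for the
    -- coefficients. The recursion only adds, because the alternating signs live in the determinant.
    -- As β < α, the quotient is at least 1, which makes the norms increase weakly and p + q grow by
    -- at least 1.
    step : ∀ {k} → Euclid u w k → Euclid u w (suc k)
    step {k} s = next (⌊_/_⌋ α 0<β (≤.trans (inj₁ 0<β) (inj₁ β<α)))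
      where
      open Euclid s
      next : (∃ λ n → fromℕ n * β ≤ α × α < fromℕ (suc n) * β) → Euclid u w (suc k)
      next (n , nβ≤α , α<[n+1]β) = record
        { p = p′ ; q = q′ ; p′ = p″ ; q′ = q″
        ; α = β ; β = β′
        ; det = ≡.trans (≡.cong ∣_∣ det-flip) (≡.trans (ℤₚ.∣-i∣≡∣i∣ (+ p ℤ.* + q′ ℤ.- + q ℤ.* + p′)) det)
        ; eq-w = eq-w′ ; eq-u = eq-u′
        ; 0<β = 0<β′-of 0≤β′
        ; β<α = <-by (gap-< α<[n+1]β)
                  (trans (solve 4 (λ i n α β → (α :- n :* β) :+ ((i :+ n) :* β :- α) := i :* β) refl 1#
                      (fromℕ n) α β)
                    (*-identityˡ β))
        ; size = ℕₚ.⊔-mono-≤ (ℕₚ.≤-trans (ℕₚ.m≤n+m p′ p) (absorb n≥1 p))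
            (ℕₚ.≤-trans (ℕₚ.m≤n+m q′ q) (absorb n≥1 q))
        ; positive = ℕₚ.≤-trans positive size
        ; large = ℕₚ.≤-trans (ℕₚ.+-mono-≤ (ℕₚ.≤-trans positive (m⊔n≤m+n p q)) large)
            (ℕₚ.≤-trans (ℕₚ.≤-reflexive (+-interchange p q p′ q′)) (ℕₚ.+-mono-≤ (absorb n≥1 p) (absorb n≥1 q)))
        }
        where
        p″ = p ℕ.+ n ℕ.* p′
        q″ = q ℕ.+ n ℕ.* q′
        β′ = α - fromℕ n * β
        cast : ∀ k k′ → fromℕ (k ℕ.+ n ℕ.* k′) ≈ fromℕ k + fromℕ n * fromℕ k′
        cast k k′ = trans (fromℤ-+ (+ k) (+ (n ℕ.* k′))) (+-congˡ (fromℕ-* n k′))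
        combine : ∀ k k′ {v} → fromℕ k′ * α + fromℕ k * β ≈ v →
                  fromℕ (k ℕ.+ n ℕ.* k′) * β + fromℕ k′ * β′ ≈ v
        combine k k′ e = trans (+-congʳ (*-congʳ (cast k k′))) (trans
          (solve 5 (λ k k′ n α β → (k :+ n :* k′) :* β :+ k′ :* (α :- n :* β) := k′ :* α :+ k :* β)
            refl (fromℕ k) (fromℕ k′) (fromℕ n) α β) e)
        eq-w′ : fromℕ p″ * β + fromℕ p′ * β′ ≈ w
        eq-w′ = combine p p′ eq-w
        eq-u′ : fromℕ q″ * β + fromℕ q′ * β′ ≈ u
        eq-u′ = combine q q′ eq-u
        0≤β′ : 0# ≤ β′
        0≤β′ = gap nβ≤α
        det-flip : + p′ ℤ.* + q″ ℤ.- + q′ ℤ.* + p″ ≡ ℤ.- (+ p ℤ.* + q′ ℤ.- + q ℤ.* + p′)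
        det-flip = ≡.trans
          (≡.cong₂ (λ x y → + p′ ℤ.* (+ q ℤ.+ x) ℤ.- + q′ ℤ.* (+ p ℤ.+ y)) (ℤₚ.pos-* n q′) (ℤₚ.pos-* n p′))
          (ℤ-solve 5 (λ p q p′ q′ n → p′ :*ℤ (q :+ℤ n :*ℤ q′) :-ℤ q′ :*ℤ (p :+ℤ n :*ℤ p′)
                        :=ℤ :-ℤ′ (p :*ℤ q′ :-ℤ q :*ℤ p′)) ≡.refl (+ p) (+ q) (+ p′) (+ q′) (+ n))
        n≥1 : 1 ℕ.≤ n
        n≥1 = one n α<[n+1]β
          where
          one : ∀ n → α < fromℕ (suc n) * β → 1 ℕ.≤ n
          one (suc n) _ = ℕ.s≤s ℕ.z≤n
          one zero α<β = contradiction β<α (≤⇒≯ (≤.trans (inj₁ α<β)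
            (≤.reflexive (trans (*-congʳ (+-identityʳ 1#)) (*-identityˡ β)))))
        absorb : 1 ℕ.≤ n → ∀ k {k′} → k ℕ.+ k′ ℕ.≤ k ℕ.+ n ℕ.* k′
        absorb 1≤n k {k′} = ℕₚ.+-monoʳ-≤ k (ℕₚ.≤-trans (ℕₚ.≤-reflexive (≡.sym (ℕₚ.*-identityˡ k′)))
            (ℕₚ.*-monoˡ-≤ k′ 1≤n))
        -- A zero remainder would make u = q″β and w = p″β commensurable: then p″u = q″w, so p″ = 0
        -- by independence and w = 0.
        0<β′-of : 0# ≤ β′ → 0# < β′
        0<β′-of (inj₁ 0<β′) = 0<β′
        0<β′-of (inj₂ 0≈β′) = contradiction w≈0 (<⇒≉ 0<w)
          where
          vanish : ∀ k k′ {v} → fromℕ k * β + fromℕ k′ * β′ ≈ v → fromℕ k * β ≈ v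
          vanish k k′ e = trans (sym (trans (+-congˡ (trans (*-congˡ (sym 0≈β′)) (zeroʳ _))) (+-identityʳ _))) e
          p″≡0 : p″ ≡ 0
          p″≡0 = independent p″ q″ (begin-equality
            fromℕ p″ * u                ≈⟨ *-congˡ (vanish q″ q′ eq-u′) ⟨
            fromℕ p″ * (fromℕ q″ * β)   ≈⟨ solve 3 (λ p q β → p :* (q :* β) := q :* (p :* β)) refl
                (fromℕ p″) (fromℕ q″) β ⟩
            fromℕ q″ * (fromℕ p″ * β)   ≈⟨ *-congˡ (vanish p″ p′ eq-w′) ⟩
            fromℕ q″ * w                ∎)
          w≈0 : w ≈ 0#
          w≈0 = trans (sym (vanish p″ p′ eq-w′)) (trans (*-congʳ (≤.Eq.reflexive (≡.cong fromℕ p″≡0)))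
              (zeroˡ β))

    module _ (start : Euclid u w 0) where

      euclid : ∀ k → Euclid u w k
      euclid zero    = start
      euclid (suc k) = step (euclid k)

  record ConvergentSequence (z : ℝ²) : Set (c ⊔ˡ ℓ) where
    field
      pair     : ℕ → Consecutive z
      chain-α   : ∀ k → Consecutive.α (pair (suc k)) ≡ Consecutive.β (pair k)
      chain-‖‖  : ∀ k → ‖ Consecutive.a (pair (suc k)) , Consecutive.b (pair (suc k)) ‖ℤ
                     ≡ ‖ Consecutive.a′ (pair k) , Consecutive.b′ (pair k) ‖ℤ
      large    : ∀ k → k ℕ.≤ 2 ℕ.* ‖ Consecutive.a′ (pair k) , Consecutive.b′ (pair k) ‖ℤ

  fromℤ-det : ∀ a b c d → fromℤ (a ℤ.* d ℤ.- b ℤ.* c) ≈ fromℤ a * fromℤ d - fromℤ b * fromℤ c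
  fromℤ-det a b c d = trans (fromℤ-+ (a ℤ.* d) (ℤ.- (b ℤ.* c)))
    (+-cong (fromℤ-* a d) (trans (fromℤ-neg (b ℤ.* c)) (-‿cong (fromℤ-* b c))))

  abs-unit-* : ∀ {i x} → ∣ i ∣ ≡ 1 → abs (fromℤ i * x) ≈ abs x
  abs-unit-* {i} {x} ∣i∣≡1 = begin-equality
    abs (fromℤ i * x)      ≈⟨ abs-* (fromℤ i) x ⟩
    abs (fromℤ i) * abs x  ≈⟨ *-congʳ (abs-fromℤ i) ⟩
    fromℕ ∣ i ∣ * abs x    ≡⟨ ≡.cong (λ n → fromℕ n * abs x) ∣i∣≡1 ⟩
    fromℕ 1 * abs x        ≈⟨ *-congʳ (+-identityʳ 1#) ⟩
    1# * abs x             ≈⟨ *-identityˡ (abs x) ⟩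
    abs x                  ∎

  module _ (z₁ z₂ : ℝ) (independent : Independent (vec z₁ z₂)) where
    private
      z = vec z₁ z₂
      u w : ℝ
      u = abs z₁
      w = abs z₂
      ε₁ ε₂ : ℤ
      ε₁ = proj₁ (∣x∣-sign z₁)
      ε₂ = proj₁ (∣x∣-sign z₂)
      ∣ε₁∣≡1 : ∣ ε₁ ∣ ≡ 1
      ∣ε₁∣≡1 = proj₁ (proj₂ (∣x∣-sign z₁))
      ∣ε₂∣≡1 : ∣ ε₂ ∣ ≡ 1
      ∣ε₂∣≡1 = proj₁ (proj₂ (∣x∣-sign z₂))

      -- The signs of z₁ and z₂, and the minus in `right`, turn the form with natural coefficients
      -- p, q into p|z₁| - q|z₂| without changing any norm.
      left right : ℕ → ℤ
      left p = ε₁ ℤ.* + p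
      right q = ℤ.- (ε₂ ℤ.* + q)

      ∣left∣ : ∀ p → ∣ left p ∣ ≡ p
      ∣left∣ p = ∣τ*i∣≡∣i∣ ε₁ (+ p) ∣ε₁∣≡1

      ∣right∣ : ∀ q → ∣ right q ∣ ≡ q
      ∣right∣ q = ≡.trans (ℤₚ.∣-i∣≡∣i∣ (ε₂ ℤ.* + q)) (∣τ*i∣≡∣i∣ ε₂ (+ q) ∣ε₂∣≡1)

      form : ∀ p q → Form (left p) (right q) z ≈ fromℕ p * u - fromℕ q * w
      form p q = begin-equality
        fromℤ (left p) * z₁ + fromℤ (right q) * z₂
          ≈⟨ +-cong (*-congʳ (fromℤ-* ε₁ (+ p))) (*-congʳ (trans (fromℤ-neg (ε₂ ℤ.* + q))
              (-‿cong (fromℤ-* ε₂ (+ q))))) ⟩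
        fromℤ ε₁ * fromℕ p * z₁ + - (fromℤ ε₂ * fromℕ q) * z₂
          ≈⟨ solve 6 (λ e p z f q y → e :* p :* z :+ (:- (f :* q)) :* y := p :* (e :* z) :- q :* (f :* y)) refl
               (fromℤ ε₁) (fromℕ p) z₁ (fromℤ ε₂) (fromℕ q) z₂ ⟩
        fromℕ p * (fromℤ ε₁ * z₁) - fromℕ q * (fromℤ ε₂ * z₂)
          ≈⟨ +-cong (*-congˡ (proj₂ (proj₂ (∣x∣-sign z₁)))) (-‿cong (*-congˡ (proj₂ (proj₂ (∣x∣-sign z₂))))) ⟩
        fromℕ p * u - fromℕ q * w ∎

      dependent : ∀ p q → fromℕ p * u ≈ fromℕ q * w → p ≡ 0 × q ≡ 0
      dependent p q e =
        let left≡0 , right≡0 = independent (left p) (right q)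
              (trans (form p q) (trans (+-congʳ e) (-‿inverseʳ _)))
        in ≡.trans (≡.sym (∣left∣ p)) (≡.cong ∣_∣ left≡0) , ≡.trans (≡.sym (∣right∣ q)) (≡.cong ∣_∣ right≡0)

      ≉⇒0<abs : ∀ {x} → 0# ≉ abs x → 0# < abs x
      ≉⇒0<abs {x} 0≉∣x∣ = [ (λ 0<∣x∣ → 0<∣x∣) , (λ 0≈∣x∣ → contradiction 0≈∣x∣ 0≉∣x∣) ]′ (0≤∣x∣ x)

      0<u : 0# < u
      0<u = ≉⇒0<abs λ 0≈u → contradiction
        (proj₁ (dependent 1 0 (trans (*-congˡ (sym 0≈u)) (trans (zeroʳ _) (sym (zeroˡ w)))))) λ ()

      0<w : 0# < w
      0<w = ≉⇒0<abs λ 0≈w → contradiction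
        (proj₂ (dependent 0 1 (trans (zeroˡ u) (sym (trans (*-congˡ (sym 0≈w)) (zeroʳ _)))))) λ ()

      one-zero : ∀ x y → fromℕ 1 * x + fromℕ 0 * y ≈ x
      one-zero x y = trans (+-cong (trans (*-congʳ (+-identityʳ 1#)) (*-identityˡ x)) (zeroˡ y)) (+-identityʳ x)

      zero-one : ∀ x y → fromℕ 0 * x + fromℕ 1 * y ≈ y
      zero-one x y = trans (+-comm _ _) (one-zero y x)

      initial : Euclid u w 0
      initial = by (u ≤?< w)
        where
        by : u ≤ w ⊎ w < u → Euclid u w 0
        by (inj₁ (inj₁ u<w)) = record
          { p = 0 ; q = 1 ; p′ = 1 ; q′ = 0 ; α = w ; β = u ; det = ≡.refl
          ; eq-w = one-zero w u ; eq-u = zero-one w u ; 0<β = 0<u ; β<α = u<w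
          ; size = ℕₚ.≤-refl ; positive = ℕₚ.≤-refl ; large = ℕ.z≤n }
        -- Equal absolute values would be a nontrivial relation with coefficients 1 and 1; the
        -- strict inequality β < α needs this case excluded.
        by (inj₁ (inj₂ u≈w)) = contradiction (proj₁ (dependent 1 1 (*-congˡ u≈w))) λ ()
        by (inj₂ w<u) = record
          { p = 1 ; q = 0 ; p′ = 0 ; q′ = 1 ; α = u ; β = w ; det = ≡.refl
          ; eq-w = zero-one u w ; eq-u = one-zero u w ; 0<β = 0<w ; β<α = w<u
          ; size = ℕₚ.≤-refl ; positive = ℕₚ.≤-refl ; large = ℕ.z≤n }

      euclid-det : ∀ p q p′ q′ → ∣ left p ℤ.* right q′ ℤ.- right q ℤ.* left p′ ∣ ≡ ∣ + p ℤ.* + q′ ℤ.- + q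
          ℤ.* + p′ ∣
      euclid-det p q p′ q′ = ≡.trans (≡.cong ∣_∣
        (ℤ-solve 6 (λ e f p q p′ q′ → (e :*ℤ p) :*ℤ (:-ℤ′ (f :*ℤ q′)) :-ℤ (:-ℤ′ (f :*ℤ q)) :*ℤ (e :*ℤ p′)
                     :=ℤ :-ℤ′ (e :*ℤ (f :*ℤ (p :*ℤ q′ :-ℤ q :*ℤ p′)))) ≡.refl ε₁ ε₂ (+ p) (+ q) (+ p′) (+ q′)))
        (≡.trans (ℤₚ.∣-i∣≡∣i∣ (ε₁ ℤ.* (ε₂ ℤ.* (+ p ℤ.* + q′ ℤ.- + q ℤ.* + p′))))
          (≡.trans (∣τ*i∣≡∣i∣ ε₁ (ε₂ ℤ.* (+ p ℤ.* + q′ ℤ.- + q ℤ.* + p′)) ∣ε₁∣≡1)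
            (∣τ*i∣≡∣i∣ ε₂ (+ p ℤ.* + q′ ℤ.- + q ℤ.* + p′) ∣ε₂∣≡1)))

      -- Inserting `eq-u` and `eq-w` into p u - q w cancels β and leaves Dα with D = ±1; likewise
      -- p′u - q′w is -Dβ. Dropping the nonnegative β-terms of `eq-w` and `eq-u` gives p′α ≤ w and
      -- q′α ≤ u, which is `bound`.
      consecutive : ∀ {k} → Euclid u w k → Consecutive z
      consecutive s = record
        { a = left p ; b = right q ; a′ = left p′ ; b′ = right q′ ; α = α ; β = β
        ; det = ≡.trans (euclid-det p q p′ q′) det
        ; value = unit D det 0≤α (trans (form p q) (trans
            (+-cong (*-congˡ (sym eq-u)) (-‿cong (*-congˡ (sym eq-w))))
            (trans (solve 6 (λ p q p′ q′ α β → p :* (q′ :* α :+ q :* β) :- q :* (p′ :* α :+ p :* β) :=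
                (p :* q′ :- q :* p′) :* α)
              refl (fromℕ p) (fromℕ q) (fromℕ p′) (fromℕ q′) α β) (*-congʳ
                  (sym (fromℤ-det (+ p) (+ q) (+ p′) (+ q′)))))))
        ; value′ = unit (ℤ.- D) (≡.trans (ℤₚ.∣-i∣≡∣i∣ D) det) (inj₁ 0<β) (trans (form p′ q′) (trans
            (+-cong (*-congˡ (sym eq-u)) (-‿cong (*-congˡ (sym eq-w))))
            (trans (solve 6 (λ p q p′ q′ α β → p′ :* (q′ :* α :+ q :* β) :- q′ :* (p′ :* α :+ p :* β) :=
                (:- (p :* q′ :- q :* p′)) :* β)
              refl (fromℕ p) (fromℕ q) (fromℕ p′) (fromℕ q′) α β)
              (*-congʳ (sym (trans (fromℤ-neg D) (-‿cong (fromℤ-det (+ p) (+ q) (+ p′) (+ q′)))))))))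
        ; 0<β = 0<β ; β<α = β<α
        ; size = ≡.subst₂ ℕ._≤_ (norm p q) (norm p′ q′) size
        ; bound = ≤.trans (≤.reflexive (*-congʳ (≤.Eq.reflexive (≡.cong fromℕ (≡.sym (norm p′ q′))))))
            (max-bound (ℕₚ.⊔-sel p′ q′))
        }
        where
        open Euclid s
        D = + p ℤ.* + q′ ℤ.- + q ℤ.* + p′
        norm : ∀ p q → p ⊔ q ≡ ‖ left p , right q ‖ℤ
        norm p q = ≡.cong₂ _⊔_ (≡.sym (∣left∣ p)) (≡.sym (∣right∣ q))
        0≤α : 0# ≤ α
        0≤α = ≤.trans (inj₁ 0<β) (inj₁ β<α)
        unit : ∀ i {x y} → ∣ i ∣ ≡ 1 → 0# ≤ x → y ≈ fromℤ i * x → abs y ≈ x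
        unit i ∣i∣≡1 0≤x e = trans (abs-cong e) (trans (abs-unit-* {i} ∣i∣≡1) (abs-nonneg 0≤x))
        partial : ∀ p p′ {v} → fromℕ p′ * α + fromℕ p * β ≈ v → fromℕ p′ * α ≤ v
        partial p p′ e = ≤-by (0≤fromℕ p ⊠ inj₁ 0<β) e
        max-bound : p′ ⊔ q′ ≡ p′ ⊎ p′ ⊔ q′ ≡ q′ → fromℕ (p′ ⊔ q′) * α ≤ ‖ z ‖
        max-bound (inj₁ e) = ≤.trans (≤.reflexive (*-congʳ (≤.Eq.reflexive (≡.cong fromℕ e))))
          (≤.trans (partial p p′ eq-w) (x≤y⊔x u w))
        max-bound (inj₂ e) = ≤.trans (≤.reflexive (*-congʳ (≤.Eq.reflexive (≡.cong fromℕ e))))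
          (≤.trans (partial q q′ eq-u) (x≤x⊔y u w))

    abstract
      convergents : ConvergentSequence (vec z₁ z₂)
      convergents = record
        { pair    = λ k → consecutive (sequence k)
        ; chain-α  = λ k → ≡.refl
        ; chain-‖‖ = λ k → ≡.refl
        ; large   = λ k → let open Euclid (sequence k) in
            ℕₚ.≤-trans large (≡.subst₂ (λ m n → p′ ℕ.+ q′ ℕ.≤ 2 ℕ.* (m ⊔ n)) (≡.sym (∣left∣ p′))
                (≡.sym (∣right∣ q′)) (m+n≤2[m⊔n] p′ q′))
        }
        where
        sequence : ∀ k → Euclid u w k
        sequence = euclid 0<w (λ p q e → proj₁ (dependent p q e)) initial

-- Approximation

module Approximation {c ℓ} (R : CompleteOrderedField c ℓ) where

  open Plane R
  open OrderedField R
  open Convergents R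
  open Sequence R
  open OrderReasoning <.strictPartialOrder

  abs-*-≤ : ∀ {x y m n} → abs x ≤ m → abs y ≤ n → abs (x * y) ≤ m * n
  abs-*-≤ {x} {y} ∣x∣≤m ∣y∣≤n = ≤.trans (≤.reflexive (abs-* x y)) (*-mono-≤ (0≤∣x∣ x) ∣x∣≤m (0≤∣x∣ y) ∣y∣≤n)

  abs-+-≤ : ∀ {x y m n} → abs x ≤ m → abs y ≤ n → abs (x + y) ≤ m + n
  abs-+-≤ {x} {y} ∣x∣≤m ∣y∣≤n = ≤.trans (abs-+ x y) (+-mono-≤ ∣x∣≤m ∣y∣≤n)

  abs-fromℤ-≤ : ∀ {i n} → ∣ i ∣ ℕ.≤ n → abs (fromℤ i) ≤ fromℕ n
  abs-fromℤ-≤ {i} ∣i∣≤n = ≤.trans (≤.reflexive (abs-fromℤ i)) (fromℕ-mono ∣i∣≤n)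

  module _ {H β : ℝ} (0≤β : 0# ≤ β) {p p′ t t′ : ℝ} (∣p∣≤H : abs p ≤ H) (∣p′∣≤H : abs p′ ≤ H)
      (near : abs (t′ - t) ≤ β) where

    -- One coordinate of γx - y. Here p and p′ are entries of v and v′, t′ is the value at x of the
    -- translated row A + lB, and the error splits as p(t′ - t) + p′β + (tp - y).
    entry-error : ∀ {y E} → abs (t * p - y) ≤ E → abs (p * t′ + p′ * β - y) ≤ fromℕ 2 * (H * β) + E
    entry-error {y} {E} close = begin
      abs (p * t′ + p′ * β - y)
        ≈⟨ abs-cong (solve 6 (λ p p′ t t′ β y → p :* t′ :+ p′ :* β :- y := p :* (t′ :- t) :+ p′ :* β :+
            (t :* p :- y)) refl p p′ t t′ β y) ⟩
      abs (p * (t′ - t) + p′ * β + (t * p - y))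
        ≤⟨ abs-+-≤ (abs-+-≤ (abs-*-≤ ∣p∣≤H near) (abs-*-≤ ∣p′∣≤H (≤.reflexive (abs-nonneg 0≤β)))) close ⟩
      H * β + H * β + E
        ≈⟨ +-congʳ (solve 1 (λ h → h :+ h := con (+ 2) :* h) refl (H * β)) ⟩
      fromℕ 2 * (H * β) + E ∎

    -- One entry of γ, multiplied by β. Writing t′ = t + (t′ - t) leaves one term t p b, bounded by
    -- YQ, and three terms bounded by HX: pξ, p(t′ - t)b and p′bβ, the last two because |b|β ≤ X.
    entry-size : ∀ {v b ξ Q X Y} → β * v ≈ ξ + t′ * b → abs ξ ≤ X → abs b ≤ Q →
                 abs t * H ≤ Y → Q * β ≤ X → abs (p * v + p′ * b) * β ≤ fromℕ 3 * (H * X) + Y * Q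
    entry-size {v} {b} {ξ} {Q} {X} {Y} βv ∣ξ∣≤X ∣b∣≤Q ∣t∣H≤Y Qβ≤X = begin
      abs (p * v + p′ * b) * β
        ≈⟨ *-congˡ (abs-nonneg 0≤β) ⟨
      abs (p * v + p′ * b) * abs β
        ≈⟨ abs-* _ β ⟨
      abs ((p * v + p′ * b) * β)
        ≈⟨ abs-cong (trans (solve 5 (λ p v p′ b β → (p :* v :+ p′ :* b) :* β := p :* (β :* v) :+ p′ :* b :*
            β) refl p v p′ b β)
             (trans (+-congʳ (*-congˡ βv))
               (solve 7 (λ p p′ b β ξ t t′ → p :* (ξ :+ t′ :* b) :+ p′ :* b :* β
                  := p :* ξ :+ t :* p :* b :+ p :* ((t′ :- t) :* b) :+ p′ :* (b :* β)) refl p p′ b β ξ t t′))) ⟩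
      abs (p * ξ + t * p * b + p * ((t′ - t) * b) + p′ * (b * β))
        ≤⟨ abs-+-≤ (abs-+-≤ (abs-+-≤ (abs-*-≤ ∣p∣≤H ∣ξ∣≤X) (abs-*-≤ (≤.trans (abs-*-≤ ≤.refl ∣p∣≤H) ∣t∣H≤Y)
            ∣b∣≤Q))
             (abs-*-≤ ∣p∣≤H (≤.trans (abs-*-≤ near ∣b∣≤Q) (≤.trans (≤.reflexive (*-comm β Q)) Qβ≤X))))
             (abs-*-≤ ∣p′∣≤H (≤.trans (abs-*-≤ ∣b∣≤Q (≤.reflexive (abs-nonneg 0≤β))) Qβ≤X)) ⟩
      H * X + Y * Q + H * X + H * X
        ≈⟨ solve 2 (λ a b → a :+ b :+ a :+ a := con (+ 3) :* a :+ b) refl (H * X) (Y * Q) ⟩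
      fromℕ 3 * (H * X) + Y * Q ∎

  ⊔-*-lub : ∀ m n {β e} → fromℕ m * β ≤ e → fromℕ n * β ≤ e → fromℕ (m ⊔ n) * β ≤ e
  ⊔-*-lub m n {β} {e} mβ≤e nβ≤e = [ via mβ≤e , via nβ≤e ]′ (ℕₚ.⊔-sel m n)
    where
    via : ∀ {k} → fromℕ k * β ≤ e → m ⊔ n ≡ k → fromℕ (m ⊔ n) * β ≤ e
    via kβ≤e m⊔n≡k = ≤.trans (≤.reflexive (*-congʳ (≤.Eq.reflexive (≡.cong fromℕ m⊔n≡k)))) kβ≤e

  fromℤ-entry : ∀ p p′ a b l → fromℤ (entry p p′ a b l) ≈
                fromℤ p * (fromℤ a + fromℤ l * fromℤ b) + fromℤ p′ * fromℤ b
  fromℤ-entry p p′ a b l = trans (fromℤ-+ (p ℤ.* (a ℤ.+ l ℤ.* b)) (p′ ℤ.* b)) (+-cong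
    (trans (fromℤ-* p (a ℤ.+ l ℤ.* b)) (*-congˡ (trans (fromℤ-+ a (l ℤ.* b)) (+-congˡ (fromℤ-* l b)))))
    (fromℤ-* p′ b))

  module _ (x₁ x₂ : ℝ) (p r p′ r′ a₁ a₂ b₁ b₂ : ℤ)
           (det-v : p ℤ.* r′ ℤ.- r ℤ.* p′ ≡ + 1) (det-B : a₁ ℤ.* b₂ ℤ.- a₂ ℤ.* b₁ ≡ + 1)
           (v′≤v : ‖ p′ , r′ ‖ℤ ℕ.≤ ‖ p , r ‖ℤ)
           {β : ℝ} (form : Form b₁ b₂ (vec x₁ x₂) ≈ β) (0<β : 0# < β)
           (Qβ≤X : fromℕ ‖ b₁ , b₂ ‖ℤ * β ≤ ‖ vec x₁ x₂ ‖)
           (t y₁ y₂ : ℝ) {E Y : ℝ} (∣t∣H≤Y : abs t * fromℕ ‖ p , r ‖ℤ ≤ Y)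
           (close₁ : abs (t * fromℤ p - y₁) ≤ E) (close₂ : abs (t * fromℤ r - y₂) ≤ E) where

    private
      x = vec x₁ x₂
      y = vec y₁ y₂
      H Q X : ℝ
      H = fromℕ ‖ p , r ‖ℤ
      Q = fromℕ ‖ b₁ , b₂ ‖ℤ
      X = ‖ x ‖

      Good : SL₂ℤ → Set ℓ
      Good γ = ‖ γ · x -ᵥ y ‖ ≤ fromℕ 2 * (H * β) + E × fromℕ ∣ γ ∣ₘ * β ≤ fromℕ 3 * (H * X) + Y * Q

      γ : ℤ → SL₂ℤ
      γ = product p r p′ r′ a₁ a₂ b₁ b₂ det-v det-B

      t′ : ℤ → ℝ
      t′ l = Form a₁ a₂ x + fromℤ l * β

      det-Bℝ : fromℤ a₁ * fromℤ b₂ - fromℤ a₂ * fromℤ b₁ ≈ 1#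
      det-Bℝ = trans (sym (fromℤ-det a₁ a₂ b₁ b₂)) (trans (≤.Eq.reflexive (≡.cong fromℤ det-B))
          (+-identityʳ 1#))

      good : ∀ l → abs (t′ l - t) ≤ β → Good (γ l)
      good l near =
        ⊔-lub (coordinate p p′ (∣p∣≤H) (∣p′∣≤H) close₁) (coordinate r r′ (∣r∣≤H) (∣r′∣≤H) close₂)
        , ⊔-*-lub (e₁ ⊔ e₂) (e₃ ⊔ e₄) (⊔-*-lub e₁ e₂ (size p p′ ∣p∣≤H ∣p′∣≤H a₁ b₁ β*V₁ ∣x₂∣≤X ∣b₁∣≤Q)
                                   (size p p′ ∣p∣≤H ∣p′∣≤H a₂ b₂ β*V₂ ∣-x₁∣≤X ∣b₂∣≤Q))
                      (⊔-*-lub e₃ e₄ (size r r′ ∣r∣≤H ∣r′∣≤H a₁ b₁ β*V₁ ∣x₂∣≤X ∣b₁∣≤Q)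
                                   (size r r′ ∣r∣≤H ∣r′∣≤H a₂ b₂ β*V₂ ∣-x₁∣≤X ∣b₂∣≤Q))
        where
        e₁ e₂ e₃ e₄ : ℕ
        e₁ = ∣ entry p p′ a₁ b₁ l ∣
        e₂ = ∣ entry p p′ a₂ b₂ l ∣
        e₃ = ∣ entry r r′ a₁ b₁ l ∣
        e₄ = ∣ entry r r′ a₂ b₂ l ∣
        ∣p∣≤H : abs (fromℤ p) ≤ H
        ∣p∣≤H = abs-fromℤ-≤ {p} (ℕₚ.m≤m⊔n (∣ p ∣) (∣ r ∣))
        ∣r∣≤H : abs (fromℤ r) ≤ H
        ∣r∣≤H = abs-fromℤ-≤ {r} (ℕₚ.m≤n⊔m (∣ p ∣) (∣ r ∣))
        ∣p′∣≤H : abs (fromℤ p′) ≤ H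
        ∣p′∣≤H = abs-fromℤ-≤ {p′} (ℕₚ.≤-trans (ℕₚ.m≤m⊔n (∣ p′ ∣) (∣ r′ ∣)) v′≤v)
        ∣r′∣≤H : abs (fromℤ r′) ≤ H
        ∣r′∣≤H = abs-fromℤ-≤ {r′} (ℕₚ.≤-trans (ℕₚ.m≤n⊔m (∣ p′ ∣) (∣ r′ ∣)) v′≤v)
        ∣b₁∣≤Q : abs (fromℤ b₁) ≤ Q
        ∣b₁∣≤Q = abs-fromℤ-≤ {b₁} (ℕₚ.m≤m⊔n (∣ b₁ ∣) (∣ b₂ ∣))
        ∣b₂∣≤Q : abs (fromℤ b₂) ≤ Q
        ∣b₂∣≤Q = abs-fromℤ-≤ {b₂} (ℕₚ.m≤n⊔m (∣ b₁ ∣) (∣ b₂ ∣))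
        ∣x₂∣≤X : abs x₂ ≤ X
        ∣x₂∣≤X = x≤y⊔x (abs x₁) (abs x₂)
        ∣-x₁∣≤X : abs (- x₁) ≤ X
        ∣-x₁∣≤X = ≤.trans (≤.reflexive (abs-neg x₁)) (x≤x⊔y (abs x₁) (abs x₂))

        V : ℤ → ℤ → ℝ
        V a b = fromℤ a + fromℤ l * fromℤ b

        β*V₁ : β * V a₁ b₁ ≈ x₂ + t′ l * fromℤ b₁
        β*V₁ = trans (*-congʳ (sym form)) (trans
          (solve 7 (λ a₁ a₂ b₁ b₂ l x₁ x₂ → (b₁ :* x₁ :+ b₂ :* x₂) :* (a₁ :+ l :* b₁)
             := (a₁ :* b₂ :- a₂ :* b₁) :* x₂ :+ (a₁ :* x₁ :+ a₂ :* x₂ :+ l :* (b₁ :* x₁ :+ b₂ :* x₂)) :* b₁)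
                 refl
             (fromℤ a₁) (fromℤ a₂) (fromℤ b₁) (fromℤ b₂) (fromℤ l) x₁ x₂)
          (+-cong (trans (*-congʳ det-Bℝ) (*-identityˡ x₂)) (*-congʳ (+-congˡ (*-congˡ form)))))
        β*V₂ : β * V a₂ b₂ ≈ - x₁ + t′ l * fromℤ b₂
        β*V₂ = trans (*-congʳ (sym form)) (trans
          (solve 7 (λ a₁ a₂ b₁ b₂ l x₁ x₂ → (b₁ :* x₁ :+ b₂ :* x₂) :* (a₂ :+ l :* b₂)
             := (a₁ :* b₂ :- a₂ :* b₁) :* (:- x₁) :+ (a₁ :* x₁ :+ a₂ :* x₂ :+ l :* (b₁ :* x₁ :+ b₂ :* x₂))
                 :* b₂) refl
             (fromℤ a₁) (fromℤ a₂) (fromℤ b₁) (fromℤ b₂) (fromℤ l) x₁ x₂)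
          (+-cong (trans (*-congʳ det-Bℝ) (*-identityˡ (- x₁))) (*-congʳ (+-congˡ (*-congˡ form)))))

        coordinate : ∀ p p′ → abs (fromℤ p) ≤ H → abs (fromℤ p′) ≤ H → ∀ {y} → abs (t * fromℤ p - y) ≤ E →
                     abs (fromℤ (entry p p′ a₁ b₁ l) * x₁ + fromℤ (entry p p′ a₂ b₂ l) * x₂ - y) ≤ fromℕ 2 *
                         (H * β) + E
        coordinate p p′ ∣p∣≤H ∣p′∣≤H {y} close = ≤.trans
          (≤.reflexive (abs-cong (+-congʳ (trans
            (+-cong (*-congʳ (fromℤ-entry p p′ a₁ b₁ l)) (*-congʳ (fromℤ-entry p p′ a₂ b₂ l)))
            (trans (solve 9 (λ p p′ a₁ a₂ b₁ b₂ l x₁ x₂ →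
              (p :* (a₁ :+ l :* b₁) :+ p′ :* b₁) :* x₁ :+ (p :* (a₂ :+ l :* b₂) :+ p′ :* b₂) :* x₂
              := p :* (a₁ :* x₁ :+ a₂ :* x₂ :+ l :* (b₁ :* x₁ :+ b₂ :* x₂)) :+ p′ :* (b₁ :* x₁ :+ b₂ :* x₂))
                  refl
              (fromℤ p) (fromℤ p′) (fromℤ a₁) (fromℤ a₂) (fromℤ b₁) (fromℤ b₂) (fromℤ l) x₁ x₂)
              (+-cong (*-congˡ (+-congˡ (*-congˡ form))) (*-congˡ form)))))))
          (entry-error (inj₁ 0<β) ∣p∣≤H ∣p′∣≤H near close)

        size : ∀ p p′ → abs (fromℤ p) ≤ H → abs (fromℤ p′) ≤ H → ∀ a b {ξ} →
               β * V a b ≈ ξ + t′ l * fromℤ b → abs ξ ≤ X → abs (fromℤ b) ≤ Q →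
               fromℕ ∣ entry p p′ a b l ∣ * β ≤ fromℕ 3 * (H * X) + Y * Q
        size p p′ ∣p∣≤H ∣p′∣≤H a b βV ∣ξ∣≤X ∣b∣≤Q = ≤.trans
          (≤.reflexive (*-congʳ (trans (sym (abs-fromℤ (entry p p′ a b l)))
              (abs-cong (fromℤ-entry p p′ a b l)))))
          (entry-size (inj₁ 0<β) ∣p∣≤H ∣p′∣≤H near βV ∣ξ∣≤X ∣b∣≤Q ∣t∣H≤Y Qβ≤X)

      -- With l the integer part of (t - A·x)/β, the target t lies between the values of A + lB and
      -- A + (l + 1)B at x, which differ by β; both multiples are therefore admissible.
      floor = ⌊_/_⌋ℤ (t - Form a₁ a₂ x) 0<β

      l : ℤ
      l = proj₁ floor

      near-below : abs (t′ l - t) ≤ β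
      near-below = abs-lub
        (≤.trans (≤-by (gap (proj₁ (proj₂ floor))) (solve 3 (λ f m t → (f :+ m :- t) :+ (t :- f :- m) := con
            (+ 0)) refl (Form a₁ a₂ x) (fromℤ l * β) t)) (inj₁ 0<β))
        (≤-by (gap (inj₁ (proj₂ (proj₂ floor)))) (solve 4 (λ f m t b → (:- (f :+ m :- t)) :+
            (m :+ b :- (t :- f)) := b) refl (Form a₁ a₂ x) (fromℤ l * β) t β))

      t′-suc : t′ (l ℤ.+ + 1) ≈ t′ l + β
      t′-suc = trans (+-congˡ (*-congʳ (trans (fromℤ-+ l (+ 1)) (+-congˡ (+-identityʳ 1#)))))
        (trans (+-congˡ (trans (distribʳ β (fromℤ l) 1#) (+-congˡ (*-identityˡ β)))) (sym (+-assoc _ _ _)))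

      near-above : abs (t′ (l ℤ.+ + 1) - t) ≤ β
      near-above = ≤.trans (≤.reflexive (abs-cong (+-congʳ t′-suc))) (abs-lub
        (≤-by (gap (proj₁ (proj₂ floor))) (solve 4 (λ f m t b → (f :+ m :+ b :- t) :+ (t :- f :- m) := b)
            refl (Form a₁ a₂ x) (fromℤ l * β) t β))
        (≤.trans (≤-by (gap (inj₁ (proj₂ (proj₂ floor)))) (solve 4 (λ f m t b → (:- (f :+ m :+ b :- t)) :+
            (m :+ b :- (t :- f)) := con (+ 0)) refl (Form a₁ a₂ x) (fromℤ l * β) t β)) (inj₁ 0<β)))

    -- If the matrix for l has norm at most G, the one for l + 1 has norm at least HQ - G, hence at
    -- least G.
    approximation : ∀ G → 2 ℕ.* G ℕ.≤ ‖ p , r ‖ℤ ℕ.* ‖ b₁ , b₂ ‖ℤ → ∃ λ γ → G ℕ.≤ ∣ γ ∣ₘ × Good γ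
    approximation G 2G≤HQ = choose (ℕₚ.≤-total G ∣ γ l ∣ₘ)
      where
      choose : G ℕ.≤ ∣ γ l ∣ₘ ⊎ ∣ γ l ∣ₘ ℕ.≤ G → ∃ λ γ → G ℕ.≤ ∣ γ ∣ₘ × Good γ
      choose (inj₁ G≤) = γ l , G≤ , good l near-below
      choose (inj₂ ≤G) = γ (l ℤ.+ + 1) , G≤ , good (l ℤ.+ + 1) near-above
        where
        G≤ : G ℕ.≤ ∣ γ (l ℤ.+ + 1) ∣ₘ
        G≤ = ℕₚ.+-cancelʳ-≤ G G _ (ℕₚ.≤-trans
          (ℕₚ.≤-reflexive (≡.cong (G ℕ.+_) (≡.sym (ℕₚ.+-identityʳ G))))
          (ℕₚ.≤-trans 2G≤HQ (ℕₚ.≤-trans (∣product∣-step p r p′ r′ a₁ a₂ b₁ b₂ det-v det-B l)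
              (ℕₚ.+-monoʳ-≤ _ ≤G))))

-- Estimates leading to the constants of (ii) and (iii)

module Bounds {c ℓ} (R : CompleteOrderedField c ℓ) where

  open Plane R
  open OrderedField R
  open Convergents R
  open Sequence R
  open Approximation R
  open OrderReasoning <.strictPartialOrder

  square-cancel-≤ : ∀ {a c} → 0# ≤ c → a ^ 2 ≤ c ^ 2 → a ≤ c
  square-cancel-≤ {a} {c} 0≤c a²≤c² = [ (λ a≤c → a≤c) , (λ c<a → contradiction
    (<-by (*-pos (gap-< c<a) (<-≤-trans (≤-<-trans 0≤c c<a) (≤-by 0≤c refl)))
      (solve 2 (λ a c → c :^ 2 :+ (a :- c) :* (a :+ c) := a :^ 2) refl a c)) (≤⇒≯ a²≤c²)) ]′ (a ≤?< c)

  cube-cancel-≤ : ∀ {a c} → 0# ≤ c → a ^ 3 ≤ c ^ 3 → a ≤ c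
  cube-cancel-≤ {a} {c} 0≤c a³≤c³ = [ (λ a≤c → a≤c) , (λ c<a → let 0<a = ≤-<-trans 0≤c c<a in contradiction
    (<-by (*-pos (gap-< c<a) (<-≤-trans (*-pos 0<a 0<a) (≤-by (inj₁ 0<a ⊠ 0≤c ⊞ 0≤c ⊠ 0≤c) refl)))
      (solve 2 (λ a c → c :^ 3 :+ (a :- c) :* (a :* a :+ (a :* c :+ c :* c)) := a :^ 3) refl a c))
          (≤⇒≯ a³≤c³)) ]′ (a ≤?< c)

  root-pos : ∀ n .{{_ : ℕ.NonZero n}} {x} → 0# < x → 0# < root n x
  root-pos (suc n) {x} 0<x = by (root-nonneg (suc n) x)
    where
    by : 0# ≤ root (suc n) x → 0# < root (suc n) x
    by (inj₁ 0<s) = 0<s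
    by (inj₂ 0≈s) = contradiction
      (trans (sym (root-^ (suc n) (inj₁ 0<x))) (trans (*-congʳ (sym 0≈s)) (zeroˡ _))) (<⇒≉ 0<x)

  -- Up to the factor X, the bound e²Γ ≤ 4H²β(3HX + YQ) has the parts 12H³β and 4H²Y, using Qβ ≤ X.
  -- The hypothesis 12Hβ ≤ 8Y reduces the first to 8H²Y, so the total is 12H²XY, the square of 2√3
  -- H√X√Y. The norm H of the primitive vector is finally replaced by the given `H₀`.
  square-bound : ∀ {e β H H₀ X Y Q Γ} → 0# ≤ e → e ≤ fromℕ 2 * (H * β) → 0# ≤ H → H ≤ H₀ → 0# < β → 0# ≤ X →
      0# ≤ Y → 0# < Γ →
                 Γ * β ≤ fromℕ 3 * (H * X) + Y * Q → Q * β ≤ X → fromℕ 12 * (H * β) ≤ fromℕ 8 * Y →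
                 e ≤ (fromℕ 2 * √ fromℕ 3 * H₀ * √ X * √ Y) / √ Γ
  square-bound {e} {β} {H} {H₀} {X} {Y} {Q} {Γ} 0≤e e≤2Hβ 0≤H H≤H₀ 0<β 0≤X 0≤Y 0<Γ Γβ≤ Qβ≤X 12Hβ≤8Y =
    *≤⇒≤/ (root-pos 2 0<Γ) (square-cancel-≤ 0≤c (begin
      (e * √ Γ) ^ 2
        ≈⟨ solve 2 (λ e s → (e :* s) :^ 2 := e :* e :* s :^ 2) refl e (√ Γ) ⟩
      e * e * √ Γ ^ 2
        ≈⟨ *-congˡ (root-^ 2 (inj₁ 0<Γ)) ⟩
      e * e * Γ
        ≤⟨ *-mono-≤ (0≤e ⊠ 0≤e) (*-mono-≤ 0≤e e≤2Hβ 0≤e e≤2Hβ) (inj₁ 0<Γ) ≤.refl ⟩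
      fromℕ 2 * (H * β) * (fromℕ 2 * (H * β)) * Γ
        ≤⟨ ≤-by ((0≤fromℕ 4 ⊠ (0≤H ⊠ 0≤H) ⊠ inj₁ 0<β) ⊠ gap Γβ≤ ⊞ ((0≤fromℕ 4 ⊠ (0≤H ⊠ 0≤H) ⊠ 0≤Y) ⊠ gap
            Qβ≤X ⊞ ((0≤H ⊠ 0≤H) ⊠ 0≤X) ⊠ gap 12Hβ≤8Y))
             (solve 6 (λ b h x y q g →
               con (+ 2) :* (h :* b) :* (con (+ 2) :* (h :* b)) :* g
               :+ ((con (+ 4) :* (h :* h) :* b) :* (con (+ 3) :* (h :* x) :+ y :* q :- g :* b)
                  :+ ((con (+ 4) :* (h :* h) :* y) :* (x :- q :* b) :+ ((h :* h) :* x) :*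
                      (con (+ 8) :* y :- con (+ 12) :* (h :* b))))
               := con (+ 12) :* ((h :* h) :* (x :* y))) refl β H X Y Q Γ) ⟩
      fromℕ 12 * ((H * H) * (X * Y))
        ≤⟨ *-mono-≤ (0≤fromℕ 12) ≤.refl ((0≤H ⊠ 0≤H) ⊠ (0≤X ⊠ 0≤Y)) (*-mono-≤ (0≤H ⊠ 0≤H)
            (*-mono-≤ 0≤H H≤H₀ 0≤H H≤H₀) (0≤X ⊠ 0≤Y) ≤.refl) ⟩
      fromℕ 12 * ((H₀ * H₀) * (X * Y))
        ≈⟨ solve 3 (λ h x y → con (+ 12) :* ((h :* h) :* (x :* y)) := con (+ 4) :* con (+ 3) :* (h :* h) :*
            x :* y) refl H₀ X Y ⟩
      fromℕ 4 * fromℕ 3 * (H₀ * H₀) * X * Y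
        ≈⟨ *-cong (*-cong (*-congʳ (*-congˡ (root-^ 2 (0≤fromℕ 3)))) (root-^ 2 0≤X)) (root-^ 2 0≤Y) ⟨
      fromℕ 4 * (√ fromℕ 3) ^ 2 * (H₀ * H₀) * (√ X) ^ 2 * (√ Y) ^ 2
        ≈⟨ solve 4 (λ s h x y → con (+ 4) :* s :^ 2 :* (h :* h) :* x :^ 2 :* y :^ 2 :=
            (con (+ 2) :* s :* h :* x :* y) :^ 2)
             refl (√ fromℕ 3) H₀ (√ X) (√ Y) ⟩
      (fromℕ 2 * √ fromℕ 3 * H₀ * √ X * √ Y) ^ 2 ∎))
    where
    0≤c : 0# ≤ fromℕ 2 * √ fromℕ 3 * H₀ * √ X * √ Y
    0≤c = 0≤fromℕ 2 ⊠ root-nonneg 2 (fromℕ 3) ⊠ ≤.trans 0≤H H≤H₀ ⊠ root-nonneg 2 X ⊠ root-nonneg 2 Y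

  cube : ∀ {x y} → 0# ≤ x → x ≤ y → x * x * x ≤ y * y * y
  cube 0≤x x≤y = *-mono-≤ (0≤x ⊠ 0≤x) (*-mono-≤ 0≤x x≤y 0≤x x≤y) 0≤x x≤y

  module _ {β E H H′ X Y Q Γ : ℝ} (0<β : 0# < β) (0≤E : 0# ≤ E) (1≤H : 1# ≤ H) (0≤H′ : 0# ≤ H′)
      (0≤X : 0# ≤ X) (0<Y : 0# < Y)
           (0≤Q : 0# ≤ Q) (0<Γ : 0# < Γ) (Γβ≤ : Γ * β ≤ fromℕ 3 * (H * X) + Y * Q) (Qβ≤X : Q * β ≤ X)
           (H³β≤Y : H * H * H * β ≤ Y) (YQ≤H³X : Y * Q ≤ H * H * H * X) (EHH′≤Y : E * H * H′ ≤ Y)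
               (Y≤H′³β : Y ≤ H′ * H′ * H′ * β) where
    private
      0≤β : 0# ≤ β
      0≤β = inj₁ 0<β
      0≤Y : 0# ≤ Y
      0≤Y = inj₁ 0<Y
      0≤H : 0# ≤ H
      0≤H = ≤.trans (inj₁ 0<1) 1≤H
      E³ = E * E * E
      0≤E³ : 0# ≤ E³
      0≤E³ = 0≤E ⊠ 0≤E ⊠ 0≤E
      H≤H² : H ≤ H * H
      H≤H² = ≤.trans (≤.reflexive (sym (*-identityˡ H))) (*-mono-≤ (inj₁ 0<1) 1≤H 0≤H ≤.refl)
      H²≤H³ : H * H ≤ H * H * H
      H²≤H³ = *-mono-≤ 0≤H H≤H² 0≤H ≤.refl
      H²β≤Y : H * H * β ≤ Y
      H²β≤Y = ≤.trans (*-mono-≤ (0≤H ⊠ 0≤H) H²≤H³ 0≤β ≤.refl) H³β≤Y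

      -- H³β²(3HX + YQ) equals 3X(H²β)² + Y(H³β)(Qβ); each factor H²β or H³β is at most Y, and Qβ ≤
      -- X.
      first : H * β * (H * β) * (H * β) * Γ ≤ fromℕ 4 * (X * (Y * Y))
      first = ≤-by ((0≤H ⊠ 0≤H ⊠ 0≤H ⊠ (0≤β ⊠ 0≤β)) ⊠ gap Γβ≤
                   ⊞ (0≤fromℕ 3 ⊠ 0≤X ⊠ gap (*-mono-≤ (0≤H ⊠ 0≤H ⊠ 0≤β) H²β≤Y (0≤H ⊠ 0≤H ⊠ 0≤β) H²β≤Y))
                   ⊞ 0≤Y ⊠ gap (*-mono-≤ (0≤H ⊠ 0≤H ⊠ 0≤H ⊠ 0≤β) H³β≤Y (0≤Q ⊠ 0≤β) Qβ≤X))
        (solve 6 (λ b h x y q g → h :* b :* (h :* b) :* (h :* b) :* g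
           :+ ((h :* h :* h :* (b :* b)) :* (con (+ 3) :* (h :* x) :+ y :* q :- g :* b)
              :+ con (+ 3) :* x :* (y :* y :- h :* h :* b :* (h :* h :* b))
              :+ y :* (y :* x :- h :* h :* h :* b :* (q :* b)))
           := con (+ 4) :* (x :* (y :* y))) refl β H X Y Q Γ)

      -- From (EHH′)³ ≤ Y³ the factor H′³ is eliminated through Y ≤ H′³β, at the price of one Y,
      -- cancelled at the end.
      E³H³≤Y²β : E³ * (H * H * H) ≤ Y * Y * β
      E³H³≤Y²β = *-cancelʳ-≤ 0<Y (begin
        E³ * (H * H * H) * Y
          ≤⟨ *-mono-≤ (0≤E³ ⊠ (0≤H ⊠ 0≤H ⊠ 0≤H)) ≤.refl 0≤Y Y≤H′³β ⟩
        E³ * (H * H * H) * (H′ * H′ * H′ * β)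
          ≈⟨ solve 4 (λ e h k b → e :* e :* e :* (h :* h :* h) :* (k :* k :* k :* b) := e :* h :* k :*
              (e :* h :* k) :* (e :* h :* k) :* b) refl E H H′ β ⟩
        E * H * H′ * (E * H * H′) * (E * H * H′) * β
          ≤⟨ *-mono-≤ (0≤EHH′ ⊠ 0≤EHH′ ⊠ 0≤EHH′) (cube 0≤EHH′ EHH′≤Y) 0≤β ≤.refl ⟩
        Y * Y * Y * β
          ≈⟨ solve 2 (λ y b → y :* y :* y :* b := y :* y :* b :* y) refl Y β ⟩
        Y * Y * β * Y ∎)
        where
        0≤EHH′ : 0# ≤ E * H * H′
        0≤EHH′ = 0≤E ⊠ 0≤H ⊠ 0≤H′

      -- After multiplication by β the size bound, with H ≤ H³ and YQ ≤ H³X, gives at most 4X E³H³,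
      -- and `E³H³≤Y²β` returns the factor β.
      second : E³ * Γ ≤ fromℕ 4 * (X * (Y * Y))
      second = *-cancelʳ-≤ 0<β (≤-by
        (0≤E³ ⊠ gap Γβ≤ ⊞ (0≤fromℕ 3 ⊠ 0≤X ⊠ 0≤E³) ⊠ gap (≤.trans H≤H² H²≤H³) ⊞ 0≤E³ ⊠ gap YQ≤H³X ⊞ 0≤fromℕ
            4 ⊠ 0≤X ⊠ gap E³H³≤Y²β)
        (solve 7 (λ b e h x y q g → e :* g :* b
            :+ (e :* (con (+ 3) :* (h :* x) :+ y :* q :- g :* b) :+ (con (+ 3) :* x :* e) :* (h :* h :* h :- h)
              :+ e :* (h :* h :* h :* x :- y :* q) :+ con (+ 4) :* x :* (y :* y :* b :- e :* (h :* h :* h)))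
            := con (+ 4) :* (x :* (y :* y)) :* b) refl β E³ H X Y Q Γ))

    -- With a = 2Hβ, the inequality (a + E)³ ≤ 4(a³ + E³) separates the two errors. Since a³ =
    -- 8(Hβ)³, `first` and `second` contribute 4 · (8 · 4 + 4) = 144.
    cube-bound-poly : ∀ {e} → 0# ≤ e → e ≤ fromℕ 2 * (H * β) + E → e * e * e * Γ ≤ fromℕ 144 * (X * (Y * Y))
    cube-bound-poly {e} 0≤e e≤ = begin
      e * e * e * Γ
        ≤⟨ *-mono-≤ (0≤e ⊠ 0≤e ⊠ 0≤e) (cube 0≤e e≤) (inj₁ 0<Γ) ≤.refl ⟩
      (a + E) * (a + E) * (a + E) * Γ
        ≤⟨ *-mono-≤ (0≤a+E ⊠ 0≤a+E ⊠ 0≤a+E) convex (inj₁ 0<Γ) ≤.refl ⟩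
      fromℕ 4 * (a * a * a + E³) * Γ
        ≤⟨ ≤-by (0≤fromℕ 32 ⊠ gap first ⊞ 0≤fromℕ 4 ⊠ gap second)
             (solve 4 (λ h e g z → con (+ 4) :* (con (+ 2) :* h :* (con (+ 2) :* h) :* (con (+ 2) :* h) :+
                 e) :* g
                :+ (con (+ 32) :* (con (+ 4) :* z :- h :* h :* h :* g) :+ con (+ 4) :*
                    (con (+ 4) :* z :- e :* g))
                := con (+ 144) :* z) refl (H * β) E³ Γ (X * (Y * Y))) ⟩
      fromℕ 144 * (X * (Y * Y)) ∎
      where
      a = fromℕ 2 * (H * β)
      0≤a : 0# ≤ a
      0≤a = 0≤fromℕ 2 ⊠ (0≤H ⊠ 0≤β)
      0≤a+E : 0# ≤ a + E
      0≤a+E = 0≤a ⊞ 0≤E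
      convex : (a + E) * (a + E) * (a + E) ≤ fromℕ 4 * (a * a * a + E³)
      convex = ≤-by (0≤fromℕ 3 ⊠ 0≤a+E ⊠ square-nonneg (a - E))
        (solve 2 (λ a e → (a :+ e) :* (a :+ e) :* (a :+ e) :+ con (+ 3) :* (a :+ e) :* ((a :- e) :* (a :- e))
           := con (+ 4) :* (a :* a :* a :+ e :* e :* e)) refl a E)

    cube-bound : ∀ {e} → 0# ≤ e → e ≤ fromℕ 2 * (H * β) + E →
                 e ≤ (fromℕ 7 * √ fromℕ 5 * ∛ X * (∛ Y) ^ 2) / ∛ Γ
    cube-bound {e} 0≤e e≤ = *≤⇒≤/ (root-pos 3 0<Γ) (≤.trans (cube-cancel-≤ 0≤6xy (begin
      (e * ∛ Γ) ^ 3
        ≈⟨ solve 2 (λ e s → (e :* s) :^ 3 := e :* e :* e :* s :^ 3) refl e (∛ Γ) ⟩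
      e * e * e * (∛ Γ) ^ 3
        ≈⟨ *-congˡ (root-^ 3 (inj₁ 0<Γ)) ⟩
      e * e * e * Γ
        ≤⟨ cube-bound-poly 0≤e e≤ ⟩
      fromℕ 144 * (X * (Y * Y))
        -- 144 is raised to 216 = 6³ so that the cube root can be taken exactly; 6 ≤ 7√5 then
        -- follows already from √5 ≥ 1.
        ≤⟨ ≤-by (0≤fromℕ 72 ⊠ (0≤X ⊠ (0≤Y ⊠ 0≤Y))) (solve 1 (λ z → con (+ 144) :* z :+ con (+ 72) :* z :=
            con (+ 216) :* z) refl (X * (Y * Y))) ⟩
      fromℕ 216 * (X * (Y * Y))
        ≈⟨ *-congˡ (*-cong (root-^ 3 0≤X) (*-cong (root-^ 3 0≤Y) (root-^ 3 0≤Y))) ⟨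
      fromℕ 216 * ((∛ X) ^ 3 * ((∛ Y) ^ 3 * (∛ Y) ^ 3))
        ≈⟨ solve 2 (λ x y → con (+ 216) :* (x :^ 3 :* (y :^ 3 :* y :^ 3)) := (con (+ 6) :* (x :* y :^ 2)) :^
            3) refl (∛ X) (∛ Y) ⟩
      (fromℕ 6 * (∛ X * (∛ Y) ^ 2)) ^ 3 ∎))
      6xy≤c)
      where
      s = √ fromℕ 5
      0≤x = root-nonneg 3 X
      0≤y = root-nonneg 3 Y
      0≤xy : 0# ≤ ∛ X * (∛ Y) ^ 2
      0≤xy = 0≤x ⊠ (0≤y ⊠ (0≤y ⊠ inj₁ 0<1))
      0≤6xy : 0# ≤ fromℕ 6 * (∛ X * (∛ Y) ^ 2)
      0≤6xy = 0≤fromℕ 6 ⊠ 0≤xy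
      1≤s : fromℕ 1 ≤ s
      1≤s = square-cancel-≤ (root-nonneg 2 (fromℕ 5)) (≤.trans
        (≤.reflexive (solve 0 (con (+ 1) :^ 2 := con (+ 1)) refl))
        (≤.trans (fromℕ-mono {1} {5} (ℕ.s≤s ℕ.z≤n)) (≤.reflexive (sym (root-^ 2 (0≤fromℕ 5))))))
      6xy≤c : fromℕ 6 * (∛ X * (∛ Y) ^ 2) ≤ fromℕ 7 * s * ∛ X * (∛ Y) ^ 2
      6xy≤c = ≤-by (0≤fromℕ 7 ⊠ gap 1≤s ⊠ 0≤xy ⊞ 0≤fromℕ 1 ⊠ 0≤xy)
        (solve 3 (λ s x y → con (+ 6) :* (x :* y) :+ (con (+ 7) :* (s :- con (+ 1)) :* (x :* y) :+ con (+ 1)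
            :* (x :* y)) := con (+ 7) :* s :* x :* y)
          refl s (∛ X) ((∛ Y) ^ 2))

-- Choice of indices and the three statements

module Main {c ℓ} (R : CompleteOrderedField c ℓ) where

  open Plane R
  open OrderedField R
  open Convergents R
  open Sequence R
  open Approximation R
  open Bounds R
  open OrderReasoning <.strictPartialOrder

  -- The sign of B is chosen to make B·z equal to β, and the sign of A to make the determinant 1.
  -- This uses up both signs, so A·z is known only in absolute value.
  record Oriented {z : ℝ²} (s : Consecutive z) : Set (c ⊔ˡ ℓ) where
    private module s = Consecutive s
    field
      a b a′ b′ : ℤ
      det     : a ℤ.* b′ ℤ.- b ℤ.* a′ ≡ + 1
      value   : abs (Form a b z) ≈ s.α
      form    : Form a′ b′ z ≈ s.β
      norm    : ‖ a , b ‖ℤ ≡ ‖ s.a , s.b ‖ℤ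
      norm′   : ‖ a′ , b′ ‖ℤ ≡ ‖ s.a′ , s.b′ ‖ℤ

  oriented : ∀ {z} (s : Consecutive z) → Oriented s
  oriented {z@(vec z₁ z₂)} s = record
    { a = σ ℤ.* a ; b = σ ℤ.* b ; a′ = τ ℤ.* a′ ; b′ = τ ℤ.* b′
    ; det = proj₂ (proj₂ flip)
    ; value = trans (abs-cong (Form-* σ a b)) (trans (abs-unit-* {σ} ∣σ∣≡1) value)
    ; form = trans (Form-* τ a′ b′) (trans (proj₂ (proj₂ (∣x∣-sign (Form a′ b′ z)))) value′)
    ; norm = ≡.cong₂ _⊔_ (∣τ*i∣≡∣i∣ σ a ∣σ∣≡1) (∣τ*i∣≡∣i∣ σ b ∣σ∣≡1)
    ; norm′ = ≡.cong₂ _⊔_ (∣τ*i∣≡∣i∣ τ a′ ∣τ∣≡1) (∣τ*i∣≡∣i∣ τ b′ ∣τ∣≡1)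
    }
    where
    open Consecutive s
    τ : ℤ
    τ = proj₁ (∣x∣-sign (Form a′ b′ z))
    ∣τ∣≡1 : ∣ τ ∣ ≡ 1
    ∣τ∣≡1 = proj₁ (proj₂ (∣x∣-sign (Form a′ b′ z)))
    flip = orient a b (τ ℤ.* a′) (τ ℤ.* b′) (≡.trans (≡.cong ∣_∣
      (ℤ-solve 5 (λ t a b c d → a :*ℤ (t :*ℤ d) :-ℤ b :*ℤ (t :*ℤ c) :=ℤ t :*ℤ (a :*ℤ d :-ℤ b :*ℤ c)) ≡.refl
          τ a b a′ b′))
      (≡.trans (∣τ*i∣≡∣i∣ τ (a ℤ.* b′ ℤ.- b ℤ.* a′) ∣τ∣≡1) det))
    σ : ℤ
    σ = proj₁ flip
    ∣σ∣≡1 : ∣ σ ∣ ≡ 1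
    ∣σ∣≡1 = proj₁ (proj₂ flip)
    Form-* : ∀ τ a b → Form (τ ℤ.* a) (τ ℤ.* b) z ≈ fromℤ τ * Form a b z
    Form-* τ a b = trans (+-cong (*-congʳ (fromℤ-* τ a)) (*-congʳ (fromℤ-* τ b)))
      (solve 5 (λ t a b x y → t :* a :* x :+ t :* b :* y := t :* (a :* x :+ b :* y)) refl (fromℤ τ)
          (fromℤ a) (fromℤ b) z₁ z₂)

  module Seq {z : ℝ²} (s : ConvergentSequence z) where
    open ConvergentSequence s

    α β : ℕ → ℝ
    α k = Consecutive.α (pair k)
    β k = Consecutive.β (pair k)

    N N′ : ℕ → ℕ
    N k = ‖ Consecutive.a (pair k) , Consecutive.b (pair k) ‖ℤ
    N′ k = ‖ Consecutive.a′ (pair k) , Consecutive.b′ (pair k) ‖ℤ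

    0<α : ∀ k → 0# < α k
    0<α k = <.trans (Consecutive.0<β (pair k)) (Consecutive.β<α (pair k))

    N′-large : ∀ n d → n ℕ.≤ N′ (d ℕ.+ 2 ℕ.* n)
    N′-large n d = ℕₚ.*-cancelˡ-≤ 2 (ℕₚ.≤-trans (ℕₚ.m≤n+m (2 ℕ.* n) d) (large (d ℕ.+ 2 ℕ.* n)))

    N-mono : ∀ {i j} → i ℕ.≤ j → N i ℕ.≤ N j
    N-mono i≤j = go (ℕₚ.≤⇒≤′ i≤j)
      where
      go : ∀ {i j} → i ℕ.≤′ j → N i ℕ.≤ N j
      go ℕ.≤′-refl = ℕₚ.≤-refl
      go (ℕ.≤′-step {j} i≤j) = ℕₚ.≤-trans (go i≤j)
        (ℕₚ.≤-trans (Consecutive.size (pair j)) (ℕₚ.≤-reflexive (≡.sym (chain-‖‖ j))))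

  module _ (x₁ x₂ : ℝ) (irrational : HasIrrationalSlope (vec x₁ x₂)) where
    private
      x = vec x₁ x₂
      xs = convergents x₁ x₂ (irrational⇒independent x irrational)
      module xs where
        open ConvergentSequence xs public
        open Seq xs public

    small-values : ∀ G → ∃ λ γ → G ℕ.≤ ∣ γ ∣ₘ × ‖ γ · x ‖ ≤ ‖ x ‖ / fromℕ ∣ γ ∣ₘ
    small-values G = γ , G≤∣γ∣ , *≤⇒≤/ (fromℕ-pos (ℕₚ.≤-trans (ℕ.s≤s ℕ.z≤n) 1+G≤∣γ∣)) (begin
        ‖ γ · x ‖ * fromℕ ∣ γ ∣ₘ
          ≤⟨ *-mono-≤ (≤.trans (0≤∣x∣ _) (x≤x⊔y _ _)) (⊔-lub (≤.reflexive o.value)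
               (≤.trans (≤.reflexive (trans (abs-cong o.form) (abs-nonneg (inj₁ s.0<β)))) (inj₁ s.β<α)))
               (0≤fromℕ ∣ γ ∣ₘ) ≤.refl ⟩
        s.α * fromℕ ∣ γ ∣ₘ
          ≈⟨ *-comm _ _ ⟩
        fromℕ ∣ γ ∣ₘ * s.α
          ≡⟨ ≡.cong (λ n → fromℕ n * s.α) ∣γ∣≡ ⟩
        fromℕ ‖ s.a′ , s.b′ ‖ℤ * s.α
          ≤⟨ s.bound ⟩
        ‖ x ‖ ∎)
      where
      k = 2 ℕ.* suc G
      s = xs.pair k
      module s = Consecutive s
      module o = Oriented (oriented s)
      γ : SL₂ℤ
      γ = mat o.a o.b o.a′ o.b′ o.det
      ∣γ∣≡ : ∣ γ ∣ₘ ≡ ‖ s.a′ , s.b′ ‖ℤ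
      ∣γ∣≡ = ≡.trans (≡.cong₂ _⊔_ o.norm o.norm′) (ℕₚ.m≤n⇒m⊔n≡n s.size)
      1+G≤∣γ∣ : suc G ℕ.≤ ∣ γ ∣ₘ
      1+G≤∣γ∣ = ℕₚ.≤-trans (xs.N′-large (suc G) 0) (ℕₚ.≤-reflexive (≡.sym ∣γ∣≡))
      G≤∣γ∣ : G ℕ.≤ ∣ γ ∣ₘ
      G≤∣γ∣ = ℕₚ.≤-trans (ℕₚ.n≤1+n G) 1+G≤∣γ∣

    0≤‖‖ : ∀ z → 0# ≤ ‖ z ‖
    0≤‖‖ (vec z₁ z₂) = ≤.trans (0≤∣x∣ z₁) (x≤x⊔y (abs z₁) (abs z₂))

    2*-cancel : ∀ H Q G → 1 ℕ.≤ H → 2 ℕ.* G ℕ.≤ Q → 2 ℕ.* G ℕ.≤ H ℕ.* Q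
    2*-cancel H Q G 1≤H 2G≤Q = ℕₚ.≤-trans 2G≤Q (ℕₚ.≤-trans (ℕₚ.≤-reflexive (≡.sym (ℕₚ.*-identityˡ Q)))
        (ℕₚ.*-monoˡ-≤ Q 1≤H))

    module _ (y₁ y₂ : ℝ) (y≉0 : ¬ IsOrigin (vec y₁ y₂)) where
      private
        y = vec y₁ y₂
        Y = ‖ y ‖

        0<Y : 0# < Y
        0<Y = [ (λ 0<Y → 0<Y) , (λ 0≈Y → contradiction
          (null (≤.trans (x≤x⊔y (abs y₁) (abs y₂)) (≤.reflexive (sym 0≈Y))) , null
              (≤.trans (x≤y⊔x (abs y₁) (abs y₂)) (≤.reflexive (sym 0≈Y)))) y≉0) ]′ (0≤‖‖ y)
          where
          null : ∀ {v} → abs v ≤ 0# → v ≈ 0#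
          null {v} ∣v∣≤0 = ≤.antisym (≤.trans (x≤∣x∣ v) ∣v∣≤0)
            (≤-by (gap (≤.trans (-x≤∣x∣ v) ∣v∣≤0)) (solve 1 (λ v → con (+ 0) :+ (con (+ 0) :- (:- v)) := v)
                refl v))

      along : ∀ p r p′ r′ → p ℤ.* r′ ℤ.- r ℤ.* p′ ≡ + 1 → ∀ t → t * fromℤ p ≈ y₁ → t * fromℤ r ≈ y₂ →
              ∀ {H₀} → ‖ p , r ‖ℤ ℕ.≤ H₀ → ∀ G → ∃ λ γ → G ℕ.≤ ∣ γ ∣ₘ ×
                ‖ γ · x -ᵥ y ‖ ≤ (fromℕ 2 * √ fromℕ 3 * fromℕ H₀ * √ ‖ x ‖ * √ Y) / √ fromℕ ∣ γ ∣ₘ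
      along p r p′ r′ det t tp≈y₁ tr≈y₂ {H₀} H≤H₀ G =
        let c′ , d′ , det′ , small = completion p r p′ r′ det
            -- The norm is required to be at least `suc G`, so that it is positive and can stand in
            -- the denominator.
            γ , large , error , size = approximation x₁ x₂ p r c′ d′ o.a o.b o.a′ o.b′ det′ o.det small
                o.form s.0<β Qβ≤X
              t y₁ y₂ ∣t∣H≤Y (exact tp≈y₁) (exact tr≈y₂) (suc G) 2G≤HQ
        in γ , ℕₚ.≤-trans (ℕₚ.n≤1+n G) large
         , square-bound (0≤‖‖ _) (≤.trans error (≤.reflexive (+-identityʳ _))) (0≤fromℕ h) (fromℕ-mono H≤H₀)
             s.0<β (0≤‖‖ x) (inj₁ 0<Y)
             (fromℕ-pos (ℕₚ.≤-trans (ℕ.s≤s ℕ.z≤n) large)) size Qβ≤X 12Hβ≤8Y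
        where
        h = ‖ p , r ‖ℤ
        H X : ℝ
        H = fromℕ h
        X = ‖ x ‖
        -- `square-bound` needs 12Hβ ≤ 8Y. As Qβ ≤ X, it is enough that 12HX ≤ Q · 8Y, which holds
        -- once Q ≥ M.
        far = archimedean-* (fromℕ 12 * (H * X)) (*-pos (fromℕ-pos {8} (ℕ.s≤s ℕ.z≤n)) 0<Y)
        M = proj₁ far
        n = M ℕ.+ 2 ℕ.* suc G
        -- The index is doubled because `large` only makes the norm at least half the index.
        s = xs.pair (2 ℕ.* n)
        module s = Consecutive s
        module o = Oriented (oriented s)
        q = ‖ o.a′ , o.b′ ‖ℤ
        Q = fromℕ q
        n≤q : n ℕ.≤ q
        n≤q = ℕₚ.≤-trans (xs.N′-large n 0) (ℕₚ.≤-reflexive (≡.sym o.norm′))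
        2G≤HQ : 2 ℕ.* suc G ℕ.≤ h ℕ.* q
        2G≤HQ = 2*-cancel h q (suc G) (det⇒‖‖≥1 p r p′ r′ det) (ℕₚ.≤-trans (ℕₚ.m≤n+m (2 ℕ.* suc G) M) n≤q)
        Qβ≤X : Q * s.β ≤ X
        Qβ≤X = ≤.trans (*-mono-≤ (0≤fromℕ q) (≤.reflexive (≤.Eq.reflexive (≡.cong fromℕ o.norm′)))
            (inj₁ s.0<β) (inj₁ s.β<α)) s.bound
        exact : ∀ {u v} → u ≈ v → abs (u - v) ≤ 0#
        exact {u} {v} u≈v = ≤.reflexive (trans (abs-cong (trans (+-congʳ u≈v) (-‿inverseʳ v)))
            (abs-nonneg ≤.refl))
        ∣t∣H≤Y : abs t * H ≤ Y
        ∣t∣H≤Y = ≤.trans (≤.reflexive (*-comm _ _)) (⊔-*-lub (∣ p ∣) (∣ r ∣)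
          (≤.trans (≤.reflexive (part p tp≈y₁)) (x≤x⊔y _ _)) (≤.trans (≤.reflexive (part r tr≈y₂)) (x≤y⊔x _ _)))
          where
          part : ∀ p {v} → t * fromℤ p ≈ v → fromℕ ∣ p ∣ * abs t ≈ abs v
          part p tp≈v = trans (*-comm _ _) (trans (*-congˡ (sym (abs-fromℤ p)))
              (trans (sym (abs-* t (fromℤ p))) (abs-cong tp≈v)))
        0<Q : 0# < Q
        0<Q = fromℕ-pos (ℕₚ.≤-trans (ℕₚ.≤-trans (ℕ.s≤s ℕ.z≤n) (ℕₚ.m≤n+m (2 ℕ.* suc G) M)) n≤q)
        12Hβ≤8Y : fromℕ 12 * (H * s.β) ≤ fromℕ 8 * Y
        12Hβ≤8Y = *-cancelʳ-≤ 0<Q (begin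
          fromℕ 12 * (H * s.β) * Q
            ≈⟨ solve 4 (λ c h b q → c :* (h :* b) :* q := c :* (h :* (q :* b))) refl (fromℕ 12) H s.β Q ⟩
          fromℕ 12 * (H * (Q * s.β))
            ≤⟨ *-mono-≤ (0≤fromℕ 12) ≤.refl (0≤fromℕ h ⊠ (inj₁ 0<Q ⊠ inj₁ s.0<β))
                (*-mono-≤ (0≤fromℕ h) ≤.refl (inj₁ 0<Q ⊠ inj₁ s.0<β) Qβ≤X) ⟩
          fromℕ 12 * (H * X)
            ≤⟨ inj₁ (proj₂ far) ⟩
          fromℕ M * (fromℕ 8 * Y)
            ≤⟨ *-mono-≤ (0≤fromℕ M) (fromℕ-mono (ℕₚ.≤-trans (ℕₚ.m≤m+n M _) n≤q)) (0≤fromℕ 8 ⊠ inj₁ 0<Y) ≤.refl ⟩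
          Q * (fromℕ 8 * Y)
            ≈⟨ *-comm _ _ ⟩
          fromℕ 8 * Y * Q ∎)

      rational-target : ∀ a b → HasSlope y a b → ∀ G → ∃ λ γ → G ℕ.≤ ∣ γ ∣ₘ ×
                ‖ γ · x -ᵥ y ‖ ≤ (fromℕ 2 * √ fromℕ 3 * fromℕ (∣ a ∣ ⊔ ∣ b ∣) * √ ‖ x ‖ * √ ‖ y ‖) / √ fromℕ
                    ∣ γ ∣ₘ
      rational-target a b (inj₂ (y₂≈0 , ≡.refl , ≡.refl)) = along (+ 1) (+ 0) (+ 0) (+ 1) ≡.refl y₁
        (trans (*-congˡ (+-identityʳ 1#)) (*-identityʳ y₁)) (trans (zeroʳ y₁) (sym y₂≈0)) ℕₚ.≤-refl
      rational-target a b (inj₁ (y₂≉0 , b≢0 , slope)) = by (primitive-direction a b b≢0)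
        where
        by : (∃ λ p → ∃ λ r → ∃ λ p′ → ∃ λ r′ → ∃ λ g →
               p ℤ.* r′ ℤ.- r ℤ.* p′ ≡ + 1 × a ≡ p ℤ.* + suc g × b ≡ r ℤ.* + suc g) →
             ∀ G → ∃ λ γ → G ℕ.≤ ∣ γ ∣ₘ ×
                ‖ γ · x -ᵥ y ‖ ≤ (fromℕ 2 * √ fromℕ 3 * fromℕ (∣ a ∣ ⊔ ∣ b ∣) * √ ‖ x ‖ * √ ‖ y ‖) / √ fromℕ
                    ∣ γ ∣ₘ
        by (p , r , p′ , r′ , g , det , ≡.refl , ≡.refl) = along p r p′ r′ det (y₂ / ρ) tp≈y₁
            (/-*-cancel ρ ρ≉0) (‖‖-*-≤ p r g)
          where
          ρ π γ : ℝ
          ρ = fromℤ r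
          π = fromℤ p
          γ = fromℕ (suc g)
          ργ≈ : fromℤ (r ℤ.* + suc g) ≈ ρ * γ
          ργ≈ = fromℤ-* r (+ suc g)
          ργ≉0 : fromℤ (r ℤ.* + suc g) ≉ 0#
          ργ≉0 = fromℤ-≢0 b≢0
          ρ≉0 : ρ ≉ 0#
          ρ≉0 ρ≈0 = ργ≉0 (trans ργ≈ (trans (*-congʳ ρ≈0) (zeroˡ γ)))
          tp≈y₁ : y₂ / ρ * π ≈ y₁
          tp≈y₁ = *-cancelʳ-≈ ργ≉0 (begin-equality
            y₂ / ρ * π * fromℤ (r ℤ.* + suc g)    ≈⟨ *-congˡ ργ≈ ⟩
            y₂ / ρ * π * (ρ * γ)                  ≈⟨ solve 4 (λ t p r g → t :* p :* (r :* g) := (t :* r) :*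
                (p :* g)) refl (y₂ / ρ) π ρ γ ⟩
            y₂ / ρ * ρ * (π * γ)                  ≈⟨ *-cong (/-*-cancel ρ ρ≉0) (sym (fromℤ-* p (+ suc g))) ⟩
            y₂ * fromℤ (p ℤ.* + suc g)            ≈⟨ *-congˡ (/-*-cancel _ ργ≉0) ⟨
            y₂ * (fromℤ (p ℤ.* + suc g) / fromℤ (r ℤ.* + suc g) * fromℤ (r ℤ.* + suc g))
                                                  ≈⟨ *-congˡ (*-congʳ slope) ⟨
            y₂ * (y₁ / y₂ * fromℤ (r ℤ.* + suc g)) ≈⟨ solve 3 (λ y s b → y :* (s :* b) := (s :* y) :* b)
                refl y₂ (y₁ / y₂) (fromℤ (r ℤ.* + suc g)) ⟩
            y₁ / y₂ * y₂ * fromℤ (r ℤ.* + suc g)  ≈⟨ *-congʳ (/-*-cancel y₂ y₂≉0) ⟩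
            y₁ * fromℤ (r ℤ.* + suc g)            ∎)

      -- t makes t (p , r) agree with y in the larger coordinate of (p , r).
      direction : ∀ p r → 1 ℕ.≤ ‖ p , r ‖ℤ → ∃ λ t → ∃ λ E → abs t * fromℕ ‖ p , r ‖ℤ ≤ Y ×
                  0# ≤ E × abs (t * fromℤ p - y₁) ≤ E × abs (t * fromℤ r - y₂) ≤ E ×
                  E * fromℕ ‖ p , r ‖ℤ ≈ abs (fromℤ p * y₂ - fromℤ r * y₁)
      direction p r 1≤H = by (ℕₚ.⊔-sel (∣ p ∣) (∣ r ∣))
        where
        H = fromℕ ‖ p , r ‖ℤ
        0<H : 0# < H
        0<H = fromℕ-pos 1≤H
        δ = abs (fromℤ p * y₂ - fromℤ r * y₁)
        0≤E : 0# ≤ δ / H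
        0≤E = 0≤∣x∣ _ ⊠ inj₁ (⁻¹-pos 0<H)

        Direction = ∃ λ t → ∃ λ E → abs t * H ≤ Y ×
                  0# ≤ E × abs (t * fromℤ p - y₁) ≤ E × abs (t * fromℤ r - y₂) ≤ E × E * H ≈ δ

        ∣fromℤ∣≈H : ∀ i → ‖ p , r ‖ℤ ≡ ∣ i ∣ → abs (fromℤ i) ≈ H
        ∣fromℤ∣≈H i e = trans (abs-fromℤ i) (≤.Eq.reflexive (≡.cong fromℕ (≡.sym e)))

        fromℤ≉0 : ∀ i → ‖ p , r ‖ℤ ≡ ∣ i ∣ → fromℤ i ≉ 0#
        fromℤ≉0 i e i≈0 = <⇒≉ 0<H (trans (sym (∣fromℤ∣≈H i e)) (trans (abs-cong i≈0) (abs-nonneg ≤.refl)))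

        exact : ∀ {u v} → u ≈ v → abs (u - v) ≤ δ / H
        exact {u} {v} u≈v = ≤.trans (≤.reflexive (trans (abs-cong (trans (+-congʳ u≈v) (-‿inverseʳ v)))
            (abs-nonneg ≤.refl))) 0≤E

        long : ∀ i {v} → ‖ p , r ‖ℤ ≡ ∣ i ∣ → abs v ≤ Y → abs (v / fromℤ i) * H ≤ Y
        long i {v} e ∣v∣≤Y = ≤.trans (≤.reflexive (trans (*-congˡ (sym (∣fromℤ∣≈H i e)))
          (trans (sym (abs-* _ _)) (abs-cong (/-*-cancel (fromℤ i) (fromℤ≉0 i e)))))) ∣v∣≤Y

        other : ∀ i {e} → ‖ p , r ‖ℤ ≡ ∣ i ∣ → abs (e * fromℤ i) ≈ δ → abs e ≤ δ / H
        other i e ei≈δ = *≤⇒≤/ 0<H (≤.reflexive (trans (*-congˡ (sym (∣fromℤ∣≈H i e)))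
            (trans (sym (abs-* _ _)) ei≈δ)))

        by : ‖ p , r ‖ℤ ≡ ∣ p ∣ ⊎ ‖ p , r ‖ℤ ≡ ∣ r ∣ → Direction
        by (inj₁ e) = y₁ / fromℤ p , δ / H , long p e (x≤x⊔y _ _) , 0≤E , exact tp≈y₁
          -- With tp = y₁, the defect tr - y₂ multiplied by p is, up to sign, the determinant of (p
          -- , r) and y; dividing by |p| = H gives E.
          , other p e (trans (abs-cong (trans
              (solve 4 (λ t p r y₂ → (t :* r :- y₂) :* p := :- (p :* y₂ :- r :* (t :* p))) refl
                  (y₁ / fromℤ p) (fromℤ p) (fromℤ r) y₂)
              (-‿cong (+-congˡ (-‿cong (*-congˡ tp≈y₁)))))) (abs-neg _))
          , /-*-cancel H (<⇒≉ 0<H)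
          where
          tp≈y₁ : y₁ / fromℤ p * fromℤ p ≈ y₁
          tp≈y₁ = /-*-cancel (fromℤ p) (fromℤ≉0 p e)
        by (inj₂ e) = y₂ / fromℤ r , δ / H , long r e (x≤y⊔x _ _) , 0≤E
          , other r e (abs-cong (trans
              (solve 4 (λ t p r y₁ → (t :* p :- y₁) :* r := p :* (t :* r) :- r :* y₁) refl (y₂ / fromℤ r)
                  (fromℤ p) (fromℤ r) y₁)
              (+-congʳ (*-congˡ tr≈y₂))))
          , exact tr≈y₂ , /-*-cancel H (<⇒≉ 0<H)
          where
          tr≈y₂ : y₂ / fromℤ r * fromℤ r ≈ y₂
          tr≈y₂ = /-*-cancel (fromℤ r) (fromℤ≉0 r e)

      _³ : ℝ → ℝ
      h ³ = h * h * h

      n≤n³ : ∀ {n} → 1 ℕ.≤ n → fromℕ n ≤ fromℕ n ³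
      n≤n³ {n} 1≤n = ≤-by (0≤fromℕ n ⊠ (gap 1≤fromℕ ⊠ (0≤fromℕ n ⊞ 0≤fromℕ 1)))
        (solve 1 (λ n → n :+ n :* ((n :- con (+ 1)) :* (n :+ con (+ 1))) := n :* n :* n) refl (fromℕ n))
        where
        1≤fromℕ : fromℕ 1 ≤ fromℕ n
        1≤fromℕ = fromℕ-mono 1≤n

      eventually-³ : ∀ {b} v → 0# < b → ∃ λ n → ∀ m → n ℕ.≤ m → v < fromℕ m ³ * b
      eventually-³ {b} v 0<b = let M , v<Mb = archimedean-* v 0<b in
        suc M , λ m M<m → <-≤-trans v<Mb (*-mono-≤ (0≤fromℕ M)
          (≤.trans (fromℕ-mono (ℕₚ.≤-trans (ℕₚ.n≤1+n M) M<m)) (n≤n³ (ℕₚ.≤-trans (ℕ.s≤s ℕ.z≤n) M<m)))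
              (inj₁ 0<b) ≤.refl)

      irrational-target : HasIrrationalSlope y → ∀ G → ∃ λ γ → G ℕ.≤ ∣ γ ∣ₘ ×
                 ‖ γ · x -ᵥ y ‖ ≤ (fromℕ 7 * √ fromℕ 5 * ∛ ‖ x ‖ * (∛ ‖ y ‖) ^ 2) / ∛ fromℕ ∣ γ ∣ₘ
      irrational-target y-irrational G = final
        where
        X = ‖ x ‖
        ys = convergents y₁ y₂ (irrational⇒independent y y-irrational)
        module ys where
          open ConvergentSequence ys public
          open Seq ys public

        Result : Set ℓ
        Result = ∃ λ γ → G ℕ.≤ ∣ γ ∣ₘ ×
                 ‖ γ · x -ᵥ y ‖ ≤ (fromℕ 7 * √ fromℕ 5 * ∛ ‖ x ‖ * (∛ ‖ y ‖) ^ 2) / ∛ fromℕ ∣ γ ∣ₘ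

        -- M ensures Y < H₀³α₀, where the search for k starts. The summand 2(G + 1) in `n₀` makes
        -- |v| large enough for 2(G + 1) ≤ H|B| whatever B is.
        M = proj₁ (eventually-³ Y (xs.0<α 0))
        n₀ = M ℕ.+ 2 ℕ.* suc G
        j₀ = suc (2 ℕ.* n₀)
        n₀≤N : n₀ ℕ.≤ ys.N j₀
        n₀≤N = ℕₚ.≤-trans (ys.N′-large n₀ 0) (ℕₚ.≤-reflexive (≡.sym (ys.chain-‖‖ (2 ℕ.* n₀))))
        H₀ : ℝ
        H₀ = fromℕ (ys.N j₀)
        1≤N₀ : 1 ℕ.≤ ys.N j₀
        1≤N₀ = ℕₚ.≤-trans (ℕₚ.≤-trans (ℕ.s≤s ℕ.z≤n) (ℕₚ.m≤n+m (2 ℕ.* suc G) M)) n₀≤N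
        0<H₀ : 0# < H₀
        0<H₀ = fromℕ-pos 1≤N₀

        module _ (k : ℕ) (Y≤H₀³α : Y ≤ H₀ ³ * xs.α k) (H₀³α′<Y : H₀ ³ * xs.α (suc k) < Y) where
          s = xs.pair k
          module s = Consecutive s
          module o = Oriented (oriented s)
          q = ‖ o.a′ , o.b′ ‖ℤ
          Q : ℝ
          Q = fromℕ q
          0<α : 0# < s.α
          0<α = xs.0<α k
          H₀³β<Y : H₀ ³ * s.β < Y
          H₀³β<Y = ≤-<-trans (≤.reflexive (*-congˡ (≤.Eq.reflexive (≡.sym (xs.chain-α k))))) H₀³α′<Y
          Qα≤X : Q * s.α ≤ X
          Qα≤X = ≤.trans (≤.reflexive (*-congʳ (≤.Eq.reflexive (≡.cong fromℕ o.norm′)))) s.bound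
          Qβ≤X : Q * s.β ≤ X
          Qβ≤X = ≤.trans (*-mono-≤ (0≤fromℕ q) ≤.refl (inj₁ s.0<β) (inj₁ s.β<α)) Qα≤X
          YQ≤H₀³X : Y * Q ≤ H₀ ³ * X
          YQ≤H₀³X = begin
            Y * Q                ≤⟨ *-mono-≤ (inj₁ 0<Y) Y≤H₀³α (0≤fromℕ q) ≤.refl ⟩
            H₀ ³ * s.α * Q       ≈⟨ trans (*-assoc _ _ _) (*-congˡ (*-comm _ _)) ⟩
            H₀ ³ * (Q * s.α)     ≤⟨ *-mono-≤ 0≤H₀³ ≤.refl (0≤fromℕ q ⊠ inj₁ 0<α) Qα≤X ⟩
            H₀ ³ * X             ∎
            where
            0≤H₀³ : 0# ≤ H₀ ³
            0≤H₀³ = inj₁ 0<H₀ ⊠ inj₁ 0<H₀ ⊠ inj₁ 0<H₀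
          1≤q : 1 ℕ.≤ q
          1≤q = det⇒‖‖≥1 o.a′ o.b′ (ℤ.- o.a) (ℤ.- o.b)
            (≡.trans (ℤ-solve 4 (λ a b c d → c :*ℤ (:-ℤ′ b) :-ℤ d :*ℤ (:-ℤ′ a) :=ℤ a :*ℤ d :-ℤ b :*ℤ c)
                ≡.refl o.a o.b o.a′ o.b′) o.det)

          module _ (j : ℕ) (j₀≤j : j₀ ℕ.≤ j) (H³β<Y : fromℕ (ys.N j) ³ * s.β < Y)
              (Y≤H′³β : Y ≤ fromℕ (ys.N (suc j)) ³ * s.β) where
            v = ys.pair j
            module v = Consecutive v
            module w = Oriented (oriented v)
            p r : ℤ
            -- The form a y₁ + b y₂ is small, so y is nearly parallel to (b , - a); the determinant
            -- of this vector and y has absolute value αⱼ.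
            p = w.b
            r = ℤ.- w.a
            h = ‖ p , r ‖ℤ
            H H′ : ℝ
            H = fromℕ h
            H′ = fromℕ (ys.N (suc j))
            h≡ : h ≡ ys.N j
            h≡ = ≡.trans (≡.cong (∣ p ∣ ⊔_) (ℤₚ.∣-i∣≡∣i∣ w.a)) (≡.trans (ℕₚ.⊔-comm (∣ p ∣) (∣ w.a ∣)) w.norm)
            H≈ : H ≈ fromℕ (ys.N j)
            H≈ = ≤.Eq.reflexive (≡.cong fromℕ h≡)
            N₀≤h : ys.N j₀ ℕ.≤ h
            N₀≤h = ℕₚ.≤-trans (ys.N-mono j₀≤j) (ℕₚ.≤-reflexive (≡.sym h≡))
            1≤h : 1 ℕ.≤ h
            1≤h = ℕₚ.≤-trans 1≤N₀ N₀≤h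
            2G≤HQ : 2 ℕ.* suc G ℕ.≤ h ℕ.* q
            2G≤HQ = ℕₚ.≤-trans (ℕₚ.≤-trans (ℕₚ.≤-trans (ℕₚ.m≤n+m (2 ℕ.* suc G) M) n₀≤N) N₀≤h)
              (ℕₚ.≤-trans (ℕₚ.≤-reflexive (≡.sym (ℕₚ.*-identityʳ h))) (ℕₚ.*-monoʳ-≤ h 1≤q))
            det-v : p ℤ.* (ℤ.- w.a′) ℤ.- r ℤ.* w.b′ ≡ + 1
            det-v = ≡.trans (ℤ-solve 4 (λ a b c d → b :*ℤ (:-ℤ′ c) :-ℤ (:-ℤ′ a) :*ℤ d :=ℤ a :*ℤ d :-ℤ b :*ℤ
                c) ≡.refl w.a w.b w.a′ w.b′) w.det
            δ≈α : abs (fromℤ p * y₂ - fromℤ r * y₁) ≈ v.α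
            δ≈α = trans (abs-cong (trans (+-congˡ (-‿cong (*-congʳ (fromℤ-neg w.a))))
              (solve 4 (λ a b x y → b :* y :- (:- a) :* x := a :* x :+ b :* y) refl (fromℤ w.a) (fromℤ w.b)
                  y₁ y₂))) w.value
            H₀≤H : H₀ ≤ H
            H₀≤H = fromℕ-mono N₀≤h
            H³β≤Y : H ³ * s.β ≤ Y
            H³β≤Y = ≤.trans (≤.reflexive (*-congʳ (*-cong (*-cong H≈ H≈) H≈))) (inj₁ H³β<Y)
            YQ≤H³X : Y * Q ≤ H ³ * X
            YQ≤H³X = ≤.trans YQ≤H₀³X (*-mono-≤ (inj₁ 0<H₀ ⊠ inj₁ 0<H₀ ⊠ inj₁ 0<H₀) (cube (inj₁ 0<H₀) H₀≤H)
                (0≤‖‖ x) ≤.refl)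

            conclude : Result
            conclude =
              -- The next convergent already completes v to determinant 1, but its norm is not the
              -- smaller one; `completion` replaces it by a vector of norm at most H.
              let c′ , d′ , det′ , small = completion p r w.b′ (ℤ.- w.a′) det-v
                  t , E , ∣t∣H≤Y , 0≤E , close₁ , close₂ , EH≈δ = direction p r 1≤h
                  γ , large , error , size = approximation x₁ x₂ p r c′ d′ o.a o.b o.a′ o.b′ det′ o.det
                      small o.form s.0<β Qβ≤X
                    t y₁ y₂ ∣t∣H≤Y close₁ close₂ (suc G) 2G≤HQ
                  EHH′≤Y : E * H * H′ ≤ Y
                  -- EH is αⱼ, and H′αⱼ ≤ Y is the bound of the sequence for y.
                  EHH′≤Y = ≤.trans (≤.reflexive (trans (*-comm _ _) (*-cong
                      (≤.Eq.reflexive (≡.cong fromℕ (ys.chain-‖‖ j))) (trans EH≈δ δ≈α)))) v.bound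
              in γ , ℕₚ.≤-trans (ℕₚ.n≤1+n G) large
               , cube-bound s.0<β 0≤E (≤.trans (≤.reflexive (sym (+-identityʳ 1#))) (fromℕ-mono 1≤h))
                   (0≤fromℕ (ys.N (suc j))) (0≤‖‖ x) 0<Y (0≤fromℕ q)
                   (fromℕ-pos (ℕₚ.≤-trans (ℕ.s≤s ℕ.z≤n) large)) size Qβ≤X H³β≤Y YQ≤H³X EHH′≤Y Y≤H′³β
                       (0≤‖‖ _) error

          choose-j : Result
          choose-j =
            -- At j₀ the lower inequality is the one gained from the choice of k. Far out the norms
            -- exceed the threshold, since β is positive and no longer varies.
            let n , v<n³β = eventually-³ Y s.0<β
                j , j₀≤j , lower , upper = crossing {P = λ j → fromℕ (ys.N j) ³ * s.β < Y}
                    {λ j → Y ≤ fromℕ (ys.N j) ³ * s.β}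
                  (λ j → (fromℕ (ys.N j) ³ * s.β) <?≤ Y) j₀ (2 ℕ.* n) H₀³β<Y
                  (inj₁ (v<n³β _ (ℕₚ.≤-trans (ℕₚ.≤-trans (ys.N′-large n j₀)
                      (ℕₚ.≤-reflexive (≡.cong ys.N′ (ℕₚ.+-comm j₀ (2 ℕ.* n)))))
                    (ℕₚ.≤-reflexive (≡.sym (ys.chain-‖‖ (2 ℕ.* n ℕ.+ j₀)))))))
            in conclude j j₀≤j lower upper

        -- Multiplying by the norm `xs.N′ k` and using `bound` turns H₀³α into at most H₀³X, so a
        -- norm beyond H₀³X/Y suffices. This ends the search for k.
        α-small : ∃ λ n → ∀ k → n ℕ.≤ xs.N′ k → H₀ ³ * xs.α k < Y
        α-small = let n , bound = archimedean-* (H₀ ³ * X) 0<Y in suc n , λ k n<N → small k n bound n<N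
          where
          small : ∀ k n → H₀ ³ * X < fromℕ n * Y → suc n ℕ.≤ xs.N′ k → H₀ ³ * xs.α k < Y
          small k n H₀³X<nY n<N = [ (λ lt → lt) , (λ Y≤H₀³α → contradiction H₀³X<nY (≤⇒≯ (begin
            fromℕ n * Y                      ≤⟨ *-mono-≤ (0≤fromℕ n) (fromℕ-mono
                (ℕₚ.≤-trans (ℕₚ.n≤1+n n) n<N)) (inj₁ 0<Y) Y≤H₀³α ⟩
            fromℕ (xs.N′ k) * (H₀ ³ * xs.α k) ≈⟨ solve 3 (λ n h a → n :* (h :* a) := h :* (n :* a)) refl
                (fromℕ (xs.N′ k)) (H₀ ³) (xs.α k) ⟩
            H₀ ³ * (fromℕ (xs.N′ k) * xs.α k) ≤⟨ *-mono-≤ (inj₁ 0<H₀ ⊠ inj₁ 0<H₀ ⊠ inj₁ 0<H₀) ≤.refl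
                (0≤fromℕ (xs.N′ k) ⊠ inj₁ (xs.0<α k)) (Consecutive.bound (xs.pair k)) ⟩
            H₀ ³ * X                         ∎))) ]′ ((H₀ ³ * xs.α k) <?≤ Y)

        final : Result
        final =
          let n , α<Y = α-small
              k , _ , lower , upper = crossing {P = λ k → Y ≤ H₀ ³ * xs.α k} {λ k → H₀ ³ * xs.α k < Y}
                (λ k → Y ≤?< (H₀ ³ * xs.α k)) 0 (2 ℕ.* n)
                (inj₁ (proj₂ (eventually-³ Y (xs.0<α 0)) (ys.N j₀) (ℕₚ.≤-trans (ℕₚ.m≤m+n M _) n₀≤N)))
                (α<Y _ (ℕₚ.≤-trans (xs.N′-large n 1) (ℕₚ.≤-reflexive (≡.cong (λ m → xs.N′ (suc m))
                    (≡.sym (ℕₚ.+-identityʳ (2 ℕ.* n)))))))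
          in choose-j k lower upper

theorem1 : ∀ {c ℓ} (R : CompleteOrderedField c ℓ) → let open Plane R in
    (x : ℝ²) → HasIrrationalSlope x →
    InfinitelyMany (λ γ → ‖ γ · x ‖ ≤ ‖ x ‖ / fromℕ ∣ γ ∣ₘ)
    ×
    ((y : ℝ²) → ¬ IsOrigin y → (a b : ℤ) → HasSlope y a b →
    InfinitelyMany (λ γ →
    ‖ γ · x -ᵥ y ‖ ≤
    (fromℕ 2 * √ fromℕ 3 * fromℕ (∣ a ∣ ⊔ ∣ b ∣) * √ ‖ x ‖ * √ ‖ y ‖)
    / √ fromℕ ∣ γ ∣ₘ))
    ×
    ((y : ℝ²) → HasIrrationalSlope y →
    InfinitelyMany (λ γ →
    ‖ γ · x -ᵥ y ‖ ≤
    (fromℕ 7 * √ fromℕ 5 * ∛ ‖ x ‖ * (∛ ‖ y ‖) ^ 2)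
    / ∛ fromℕ ∣ γ ∣ₘ))
theorem1 R (Plane.vec x₁ x₂) irrational =
    unbounded⇒infinite (small-values x₁ x₂ irrational)
  , (λ { (Plane.vec y₁ y₂) y≉0 a b slope →
         unbounded⇒infinite (rational-target x₁ x₂ irrational y₁ y₂ y≉0 a b slope) })
  , (λ { (Plane.vec y₁ y₂) y-irrational@(y₂≉0 , _) →
         unbounded⇒infinite (irrational-target x₁ x₂ irrational y₁ y₂ (λ y≈0 → y₂≉0 (proj₂ y≈0))
             y-irrational) })
  where open Main R
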